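{- Let $f$ be a closure operator on a finite set $E$. The following are equivalent: (i) the Bergman complex $\widetilde{\Delta}_f$ is shellable; (ii) for every proper flat $F$ of $f$, the Bergman complex $\widetilde{\Delta}_{f/F}$ is shellable; (iii) the augmented Bergman complex $\Delta_f$ admits a shelling order in which the maximal flags (facets containing no vertex $y_i$) appear first and the bases (facets containing no vertex $x_F$) appear last; (iv) the augmented Bergman complex $\Delta_f$ is shellable.
   Context: A closure operator on a finite set $E$ is a map $f:2^E\to 2^E$ with $A\subseteq f(A)$, $A\subseteq B\Rightarrow f(A)\subseteq f(B)$, and $f(f(A))=f(A)$. A flat is a set $F$ with $f(F)=F$; it is proper if $F\ne E$. A set $I\subseteq E$ is independent if $f(I\setminus\{i\})\subsetneq f(I)$ for every $i\in I$; a basis is an independent set with $f(I)=E$. The Bergman complex $\widetilde{\Delta}_f$ has a vertex $x_F$ for each flat $F$ with $f(\emptyset)\subsetneq F\subsetneq E$, and faces $\{x_{F_1},\dots,x_{F_\ell}\}$ for chains of flats $f(\emptyset)\subsetneq F_1\subsetneq\cdots\subsetneq F_\ell\subsetneq E$. The augmented Bergman complex $\Delta_f$ has vertex set $\{y_i\mid i\in E\}\sqcup\{x_F\mid F \text{ a proper flat of } f\}$ (including $F=f(\emptyset)$ if $f(\emptyset)\neq E$), and faces $\{y_i\mid i\in I\}\sqcup\{x_{F_1},\dots,x_{F_\ell}\}$ where $I$ is independent and $f(I)\subseteq F_1\subsetneq\cdots\subsetneq F_\ell\subsetneq E$ are flats ($\ell\ge0$). For a flat $F$, the contraction $f/F:2^{E\setminus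 F}\to 2^{E\setminus F}$ is $(f/F)(A)=f(A\cup F)\setminus F$. A (not necessarily pure) simplicial complex is shellable if its facets can be ordered $\sigma_1,\dots,\sigma_k$ so that for each $2\le i\le k$ the complex $\langle\sigma_1,\dots,\sigma_{i-1}\rangle\cap\langle\sigma_i\rangle$ is pure of dimension $\dim(\sigma_i)-1$, where $\langle\cdot\rangle$ denotes the complex generated by the given faces. -}

module Defs where

open import Data.Nat using (ℕ; _∸_)
open import Data.Bool using (Bool; true; false; _∧_; not)
open import Data.Fin using (Fin)
open import Data.Fin.Properties using (_≟_)
open import Data.Fin.Subset using (Subset; _∈_; _⊆_; _⊂_; _∪_; _-_; ⊤; ⊥)
open import Data.Fin.Subset.Properties using (_∈?_)
open import Data.Vec using (lookup; tabulate)
open import Data.List using (List; []; _∷_; _++_; length; filter; allFin; mapMaybe)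
open import Data.Bool.ListAction using (any)
open import Data.List.Membership.Propositional using () renaming (_∈_ to _∈ₗ_)
import Data.List.Relation.Binary.Subset.Propositional as LS
open import Data.List.Relation.Unary.Unique.Propositional using (Unique)
open import Data.List.Relation.Unary.All using (All)
open import Data.List.Relation.Unary.AllPairs using (AllPairs)
open import Data.Maybe using (Maybe; just; nothing)
open import Data.Sum using (_⊎_; inj₁; inj₂)
open import Data.Product using (Σ; ∃; _×_; _,_)
open import Relation.Nullary using (¬_; ⌊_⌋)
open import Relation.Nullary.Decidable using (¬?)
open import Relation.Binary.PropositionalEquality using (_≡_; _≢_)

record ClosureOperator (n : ℕ) : Set where
  field
    cl         : Subset n → Subset n
    extensive  : ∀ A → A ⊆ cl A
    monotone   : ∀ {A B} → A ⊆ B → cl A ⊆ cl B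
    idempotent : ∀ A → cl (cl A) ≡ cl A

-- The notions below only use the underlying map 2^E → 2^E.
module _ {n : ℕ} (f : Subset n → Subset n) where

  IsFlat : Subset n → Set
  IsFlat F = f F ≡ F

  -- proper flat: a flat F ≠ E (includes f(∅) when f(∅) ≠ E)
  IsProperFlat : Subset n → Set
  IsProperFlat F = IsFlat F × F ≢ ⊤

  Independent : Subset n → Set
  Independent I = ∀ i → i ∈ I → f (I - i) ⊂ f I

  IsBasis : Subset n → Set
  IsBasis I = Independent I × f I ≡ ⊤

-- Simplicial complexes.  A complex with vertex type V is given by its
-- face predicate on lists of vertices; a list stands for the finite set
-- of its elements (face predicates below depend only on membership).

Complex : Set → Set₁
Complex V = List V → Set

module _ {V : Set} where

  _⊆ₗ_ : List V → List V → Set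
  _⊆ₗ_ = LS._⊆_

  IsFacet : Complex V → List V → Set
  IsFacet K σ = Unique σ × K σ × (∀ τ → K τ → σ ⊆ₗ τ → τ ⊆ₗ σ)

  IntersectionComplex : List (List V) → List V → Complex V
  IntersectionComplex pre σ τ = τ ⊆ₗ σ × (∃ λ ρ → ρ ∈ₗ pre × τ ⊆ₗ ρ)

  -- pure of dimension d-1 : all facets have exactly d vertices
  PureCard : Complex V → ℕ → Set
  PureCard K d = ∀ τ → IsFacet K τ → length τ ≡ d

  SameSet : List V → List V → Set
  SameSet σ τ = σ ⊆ₗ τ × τ ⊆ₗ σ

  IsShelling : Complex V → List (List V) → Set
  IsShelling K σs =
      All (IsFacet K) σs
    × (∀ σ → IsFacet K σ → ∃ λ ρ → ρ ∈ₗ σs × SameSet σ ρ)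
    × AllPairs (λ σ τ → ¬ SameSet σ τ) σs
    × (∀ pre σ post → σs ≡ pre ++ σ ∷ post → pre ≢ [] →
         PureCard (IntersectionComplex pre σ) (length σ ∸ 1))

  Shellable : Complex V → Set
  Shellable K = ∃ λ σs → IsShelling K σs

module _ {n : ℕ} (f : Subset n → Subset n) where

  Bergman : Complex (Subset n)
  Bergman L =
      All (λ F → IsFlat f F × f ⊥ ⊂ F × F ⊂ ⊤) L
    × (∀ F G → F ∈ₗ L → G ∈ₗ L → F ⊆ G ⊎ G ⊆ F)

  -- vertices y_i = inj₁ i, x_F = inj₂ F
  yPart : List (Fin n ⊎ Subset n) → List (Fin n)
  yPart = mapMaybe (λ { (inj₁ i) → just i ; (inj₂ _) → nothing })

  xPart : List (Fin n ⊎ Subset n) → List (Subset n)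
  xPart = mapMaybe (λ { (inj₁ _) → nothing ; (inj₂ F) → just F })

  toSubset : List (Fin n) → Subset n
  toSubset is = tabulate (λ j → any (λ i → ⌊ i ≟ j ⌋) is)

  AugmentedBergman : Complex (Fin n ⊎ Subset n)
  AugmentedBergman L =
      Independent f (toSubset (yPart L))
    × All (λ F → IsProperFlat f F × f (toSubset (yPart L)) ⊆ F) (xPart L)
    × (∀ F G → F ∈ₗ xPart L → G ∈ₗ xPart L → F ⊆ G ⊎ G ⊆ F)

  NoY : List (Fin n ⊎ Subset n) → Set
  NoY L = yPart L ≡ []

  NoX : List (Fin n ⊎ Subset n) → Set
  NoX L = xPart L ≡ []

  FlagsFirstBasesLastShellable : Set
  FlagsFirstBasesLastShellable =
    ∃ λ σs → IsShelling AugmentedBergman σs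
           × AllPairs (λ σ τ → (NoY τ → NoY σ) × (NoX σ → NoX τ)) σs

-- Contraction f/F, with ground set E ∖ F identified with Fin m
-- (m = |E ∖ F|) via the order-preserving enumeration ι of E ∖ F.

module _ {n : ℕ} (F : Subset n) where

  complementList : List (Fin n)
  complementList = filter (λ i → ¬? (i ∈? F)) (allFin n)

  cardCompl : ℕ
  cardCompl = length complementList

  ι : Fin cardCompl → Fin n
  ι = Data.List.lookup complementList

  liftSub : Subset cardCompl → Subset n
  liftSub A = tabulate (λ i → any (λ j → lookup A j ∧ ⌊ ι j ≟ i ⌋) (allFin cardCompl))

contract : ∀ {n} → (Subset n → Subset n) → (F : Subset n) →
           Subset (cardCompl F) → Subset (cardCompl F)
contract f F A = tabulate (λ j → lookup (f (liftSub F A ∪ F)) (ι F j))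

{-# OPTIONS --safe #-}
-- Links of a shellable complex are shellable: restrict the shelling to the facets containing the face.
-- The chains in (F, E) form the link in the Bergman complex of a maximal chain of (f(∅), F], and the
-- Bergman complex is the link of x_{f(∅)} in Δ_f; this gives (i) ⇒ (ii) and (iv) ⇒ (i).
-- For (ii) ⇒ (iii), a facet of Δ_f is an independent set I together with a maximal chain of [f(I), E), and
-- these chains are ordered by coning the shelling of the Bergman complex of f/f(I) over x_{f(I)}. Order the
-- facets by |f(I)|. An independent J before I with J ≠ I misses some i ∈ I, since I ⊊ J would force
-- |f(I)| < |f(J)|; deleting y_i leaves a ridge which extends to a facet over I − i, and |f(I − i)| < |f(I)|.
-- The minimal value |f(∅)| is attained by I = ∅ alone, and the maximal value |E| exactly by the bases.

module Submission where

open import Defs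
open import Data.Bool as Bool using (Bool; true; false; T)
import Data.Bool.Properties as Boolₚ
open import Data.Empty using (⊥-elim)
open import Data.Fin using (Fin; zero; suc)
import Data.Fin.Properties as Fin
open import Data.Fin.Subset using (Subset; ⊤; ⊥; _-_; _∪_; ∣_∣)
  renaming (_∈_ to _∈ˢ_; _∉_ to _∉ˢ_; _⊆_ to _⊆ˢ_; _⊂_ to _⊂ˢ_)
open import Data.Fin.Subset.Properties
  using (⊆-antisym; ⊆-trans; ⊆-⊂-trans; ⊆⊤; ⊥⊆; ∉⊥; ∈⊤; x∈p∪q⁺; x∈p∪q⁻; q⊆p∪q; p─q⊆p; x∈p∧x≢y⇒x∈p-y; p⊂q⇒∣p∣<∣q∣)
  renaming (_∈?_ to _∈ˢ?_; _⊆?_ to _⊆ˢ?_; _⊂?_ to _⊂ˢ?_)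
open import Data.List as List using (List; []; _∷_; _++_; length; map; filter; concatMap; allFin)
open import Data.List.Extrema.Nat using (argmax; argmax-sel; f[xs]≤f[argmax])
import Data.List.Membership.DecPropositional as DecMembership
open import Data.List.Membership.Propositional using (_∈_; _∉_; find; lose)
open import Data.List.Membership.Propositional.Properties
open import Data.List.Properties using (++-assoc)
open import Data.List.Relation.Binary.Disjoint.Propositional using (Disjoint)
open import Data.List.Relation.Binary.Permutation.Propositional using (↭-sym; ↭⇒↭ₛ)
open import Data.List.Relation.Binary.Permutation.Propositional.Properties using (∈-resp-↭)
open import Data.List.Relation.Binary.Permutation.Setoid.Properties using (Unique-resp-↭)
open import Data.List.Relation.Binary.Subset.Propositional using (_⊆_)
import Data.List.Relation.Binary.Subset.Propositional.Properties as Subsetₚ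
open import Data.List.Relation.Unary.All as All using (All; []; _∷_)
open import Data.List.Relation.Unary.All.Properties using (¬All⇒Any¬)
open import Data.List.Relation.Unary.AllPairs using (AllPairs; []; _∷_)
open import Data.List.Relation.Unary.Any as Any using (here; there)
import Data.List.Relation.Unary.Any.Properties as Anyₚ
open import Data.List.Relation.Unary.Sorted.TotalOrder.Properties using (Sorted⇒AllPairs)
open import Data.List.Relation.Unary.Unique.Propositional using (Unique)
import Data.List.Relation.Unary.Unique.Propositional.Properties as Uniqueₚ
open import Data.Nat using (ℕ; suc; _∸_; _≤_; z≤n; s≤s)
open import Data.Nat.Properties
  using (≤-refl; ≤-trans; ≤-antisym; 1+n≰n; <⇒≱; ≤⇒≯; ≤-totalOrder; ≤-decTotalOrder)
open import Data.Product using (∃; ∃₂; _×_; _,_; proj₁; proj₂)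
open import Data.Sum as Sum using (_⊎_; inj₁; inj₂)
import Data.Sum.Properties as Sumₚ
open import Data.Vec as Vec using ([]; _∷_; there)
import Data.Vec.Properties as Vecₚ
open import Function using (_∘_; id; case_of_)
open import Function.Bundles using (_⇔_; mk⇔; Equivalence)
open import Relation.Binary using (DecidableEquality)
import Relation.Binary.Construct.On as On
open import Relation.Binary.PropositionalEquality
  using (_≡_; _≢_; refl; sym; trans; cong; setoid; subst; subst₂)
open import Relation.Nullary using (¬_; Dec; yes; no; contradiction)
open import Relation.Nullary.Decidable as Dec using (¬?; _×-dec_; _⊎-dec_; _→-dec_; fromWitness; toWitness)
open import Relation.Unary using (Pred; Decidable)

-- Initial segments of a list, and counting in lists without repetitions.

module _ {A : Set} where

  -- An inductive form of `xs ≡ pre ++ x ∷ post` with `post` hidden, so that positions in `map`,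
  -- `filter` and `concatMap` lists can be inverted by structural recursion.
  data Initial : List A → A → List A → Set where
    here  : ∀ {x xs} → Initial [] x (x ∷ xs)
    there : ∀ {y pre x xs} → Initial pre x xs → Initial (y ∷ pre) x (y ∷ xs)

  initial⁺ : ∀ pre {x post} → Initial pre x (pre ++ x ∷ post)
  initial⁺ []        = here
  initial⁺ (_ ∷ pre) = there (initial⁺ pre)

  initial⁻ : ∀ {pre x xs} → Initial pre x xs → ∃ λ post → xs ≡ pre ++ x ∷ post
  initial⁻ here      = _ , refl
  initial⁻ (there s) with initial⁻ s
  ... | post , refl = post , refl

  initial-∈ : ∀ {pre x xs} → Initial pre x xs → x ∈ xs
  initial-∈ here      = here refl
  initial-∈ (there s) = there (initial-∈ s)

  initial-⊆ : ∀ {pre x xs} → Initial pre x xs → pre ⊆ xs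
  initial-⊆ (there s) (here eq) = here eq
  initial-⊆ (there s) (there p) = there (initial-⊆ s p)

  module _ {R : A → A → Set} where

    initial⇒AllPairs : ∀ xs → (∀ {pre x y} → Initial pre x xs → y ∈ pre → R y x) →
                       AllPairs R xs
    initial⇒AllPairs []       r = []
    initial⇒AllPairs (x ∷ xs) r =
      All.tabulate later ∷ initial⇒AllPairs xs (λ s y∈ → r (there s) (there y∈))
      where
      later : ∀ {y} → y ∈ xs → R x y
      later y∈ with ∈-∃++ y∈
      ... | pre , _ , refl = r (there (initial⁺ pre)) (here refl)

    AllPairs⇒initial : ∀ {xs} → AllPairs R xs →
                       ∀ {pre x y} → Initial pre x xs → y ∈ pre → R y x
    AllPairs⇒initial (r ∷ rs) (there s) (here refl) = All.lookup r (initial-∈ s)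
    AllPairs⇒initial (r ∷ rs) (there s) (there y∈)  = AllPairs⇒initial rs s y∈

    -- An entry standing after `x` would satisfy `R x y`. This later puts `I - i`, whose closure is
    -- smaller, before `I`.
    initial-backward : ∀ {xs} → AllPairs R xs → ∀ {pre x y} → Initial pre x xs →
                       y ∈ xs → ¬ R x y → y ≢ x → y ∈ pre
    initial-backward (r ∷ rs) here      (here eq)  ¬r y≢x = contradiction eq y≢x
    initial-backward (r ∷ rs) here      (there y∈) ¬r y≢x = contradiction (All.lookup r y∈) ¬r
    initial-backward (r ∷ rs) (there s) (here eq)  ¬r y≢x = here eq
    initial-backward (r ∷ rs) (there s) (there y∈) ¬r y≢x = there (initial-backward rs s y∈ ¬r y≢x)

  initial-filter⁻ : ∀ {ℓ} {P : Pred A ℓ} (P? : Decidable P) xs {pre x} →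
    Initial pre x (filter P? xs) → ∃ λ pre′ → Initial pre′ x xs × pre ≡ filter P? pre′
  initial-filter⁻ P? (x ∷ xs) s with P? x in eq
  initial-filter⁻ P? (x ∷ xs) here | yes _ = [] , here , refl
  initial-filter⁻ P? (x ∷ xs) (there s) | yes _ with initial-filter⁻ P? xs s
  ... | pre′ , s′ , refl = x ∷ pre′ , there s′ , lem
    where
    lem : x ∷ filter P? pre′ ≡ filter P? (x ∷ pre′)
    lem rewrite eq = refl
  initial-filter⁻ P? (x ∷ xs) s | no _ with initial-filter⁻ P? xs s
  ... | pre′ , s′ , refl = x ∷ pre′ , there s′ , lem
    where
    lem : filter P? pre′ ≡ filter P? (x ∷ pre′)
    lem rewrite eq = refl

  initial-++⁻ : ∀ xs {ys pre x} → Initial pre x (xs ++ ys) →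
    Initial pre x xs ⊎ ∃ λ pre′ → Initial pre′ x ys × pre ≡ xs ++ pre′
  initial-++⁻ []       s         = inj₂ (_ , s , refl)
  initial-++⁻ (_ ∷ xs) here      = inj₁ here
  initial-++⁻ (_ ∷ xs) (there s) with initial-++⁻ xs s
  ... | inj₁ s′               = inj₁ (there s′)
  ... | inj₂ (pre′ , s′ , eq) = inj₂ (pre′ , s′ , cong (_ ∷_) eq)

  ∈-++-∷⁺ : ∀ (xs : List A) {ys} {x y : A} → y ∈ xs ++ ys → y ∈ xs ++ x ∷ ys
  ∈-++-∷⁺ []       y∈        = there y∈
  ∈-++-∷⁺ (_ ∷ xs) (here eq) = here eq
  ∈-++-∷⁺ (_ ∷ xs) (there p) = there (∈-++-∷⁺ xs p)

  ∈-++-∷⁻ : ∀ (xs : List A) {ys} {x y : A} → y ∈ xs ++ x ∷ ys → y ≢ x → y ∈ xs ++ ys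
  ∈-++-∷⁻ []       (here eq)  y≢x = contradiction eq y≢x
  ∈-++-∷⁻ []       (there y∈) y≢x = y∈
  ∈-++-∷⁻ (_ ∷ xs) (here eq)  y≢x = here eq
  ∈-++-∷⁻ (_ ∷ xs) (there p)  y≢x = there (∈-++-∷⁻ xs p y≢x)

  length-++-∷ : ∀ xs {ys} {x : A} → length (xs ++ x ∷ ys) ≡ suc (length (xs ++ ys))
  length-++-∷ []       = refl
  length-++-∷ (_ ∷ xs) = cong suc (length-++-∷ xs)

  Unique-++-∷⁻ : ∀ xs {ys} {x : A} → Unique (xs ++ x ∷ ys) →
                 Unique (xs ++ ys) × x ∉ xs ++ ys
  Unique-++-∷⁻ []       (x≢ ∷ u) = u , λ x∈ → All.lookup x≢ x∈ refl
  Unique-++-∷⁻ (y ∷ xs) (y≢ ∷ u) with Unique-++-∷⁻ xs u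
  ... | u′ , x∉ = All.tabulate (All.lookup y≢ ∘ ∈-++-∷⁺ xs) ∷ u′ ,
    λ { (here refl) → All.lookup y≢ (∈-++⁺ʳ xs (here refl)) refl ; (there p) → x∉ p }

  length-mono-⊆ : ∀ {xs} → Unique xs → ∀ {ys} → xs ⊆ ys → length xs ≤ length ys
  length-mono-⊆ []       xs⊆ys = z≤n
  length-mono-⊆ (x≢ ∷ u) xs⊆ys with ∈-∃++ (xs⊆ys (here refl))
  ... | as , bs , refl = subst (_ ≤_) (sym (length-++-∷ as))
    (s≤s (length-mono-⊆ u (λ p → ∈-++-∷⁻ as (xs⊆ys (there p)) (λ eq → All.lookup x≢ p (sym eq)))))

module _ {A B : Set} where

  initial-map⁻ : ∀ (f : A → B) xs {pre y} → Initial pre y (map f xs) →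
    ∃₂ λ pre′ x → Initial pre′ x xs × pre ≡ map f pre′ × y ≡ f x
  initial-map⁻ f (x ∷ xs) here      = [] , x , here , refl , refl
  initial-map⁻ f (x ∷ xs) (there s) with initial-map⁻ f xs s
  ... | pre′ , x′ , s′ , refl , refl = x ∷ pre′ , x′ , there s′ , refl , refl

  initial-concatMap⁻ : ∀ (f : A → List B) xs {pre y} → Initial pre y (concatMap f xs) →
    ∃₂ λ as x → ∃ λ pre′ → Initial as x xs × Initial pre′ y (f x) × pre ≡ concatMap f as ++ pre′
  initial-concatMap⁻ f (x ∷ xs) s with initial-++⁻ (f x) s
  ... | inj₁ s′ = [] , x , _ , here , s′ , refl
  ... | inj₂ (pre′ , s′ , refl) with initial-concatMap⁻ f xs s′
  ... | as , x′ , pre″ , t , t′ , refl =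
    x ∷ as , x′ , pre″ , there t , t′ , sym (++-assoc (f x) (concatMap f as) pre″)

-- Shellings in exchange form.

module _ {V : Set} where

  -- The pairwise form of the shelling condition: ρ ∩ σ lies in the ridge σ ∖ {v}, which lies in an earlier facet.
  Exchange : List (List V) → List V → List V → Set
  Exchange pre ρ σ = ∃ λ v → v ∈ σ × v ∉ ρ × ∃ λ ρ′ → ρ′ ∈ pre × (∀ {w} → w ∈ σ → w ≢ v → w ∈ ρ′)

  -- Stated with single vertices instead of purity, the condition can be transported through links,
  -- cones and relabellings one vertex at a time.
  record ExchangeShelling (K : Complex V) (σs : List (List V)) : Set where
    field
      facets   : All (IsFacet K) σs
      cover    : ∀ {σ} → IsFacet K σ → ∃ λ ρ → ρ ∈ σs × SameSet σ ρ
      exchange : ∀ {pre σ} → Initial pre σ σs → ∀ {ρ} → ρ ∈ pre → Exchange pre ρ σ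

  open ExchangeShelling public

  ExchangeShellable : Complex V → Set
  ExchangeShellable K = ∃ (ExchangeShelling K)

  -- The exchange vertex `v` for an earlier facet containing `τ` is outside `τ`, so `τ` lies in the
  -- ridge `σ` minus `v`. That ridge is itself a face of the intersection, and maximality of `τ`
  -- makes the two equal.
  exchange⇒shelling : ∀ {K σs} → ExchangeShelling K σs → IsShelling K σs
  exchange⇒shelling {K} {σs} E =
    facets E , (λ _ → cover E) , initial⇒AllPairs σs distinct , pure
    where
    distinct : ∀ {pre σ ρ} → Initial pre σ σs → ρ ∈ pre → ¬ SameSet ρ σ
    distinct s ρ∈ (_ , σ⊆ρ) with exchange E s ρ∈
    ... | v , v∈σ , v∉ρ , _ = v∉ρ (σ⊆ρ v∈σ)

    pure : ∀ pre σ post → σs ≡ pre ++ σ ∷ post → pre ≢ [] →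
           PureCard (IntersectionComplex pre σ) (length σ ∸ 1)
    pure pre σ post refl _ τ (uτ , (τ⊆σ , ρ , ρ∈ , τ⊆ρ) , maximal)
      with exchange E (initial⁺ pre) ρ∈
    ... | v , v∈σ , v∉ρ , ρ′ , ρ′∈ , σ-v⊆ρ′ with ∈-∃++ v∈σ
    ... | as , bs , refl = trans (≤-antisym (length-mono-⊆ uτ τ⊆ridge) (length-mono-⊆ uridge ridge⊆τ))
                                 (cong (_∸ 1) (sym (length-++-∷ as)))
      where
      uσ : Unique (as ++ v ∷ bs)
      uσ = proj₁ (All.lookup (facets E) (∈-++⁺ʳ pre (here refl)))

      uridge : Unique (as ++ bs)
      uridge = proj₁ (Unique-++-∷⁻ as uσ)

      τ⊆ridge : τ ⊆ as ++ bs
      τ⊆ridge w∈τ = ∈-++-∷⁻ as (τ⊆σ w∈τ) λ { refl → v∉ρ (τ⊆ρ w∈τ) }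

      ridge⊆τ : as ++ bs ⊆ τ
      ridge⊆τ = maximal (as ++ bs)
        (∈-++-∷⁺ as , ρ′ , ρ′∈ ,
         λ w∈ → σ-v⊆ρ′ (∈-++-∷⁺ as w∈) λ { refl → proj₂ (Unique-++-∷⁻ as uσ) w∈ })
        τ⊆ridge

module _ {V : Set} (_≟_ : DecidableEquality V) where
  open DecMembership _≟_ using (_∈?_)

  ⊆-length⇒⊇ : ∀ {xs ys : List V} → Unique xs → xs ⊆ ys → length ys ≤ length xs → ys ⊆ xs
  ⊆-length⇒⊇ {xs} {ys} u xs⊆ys len {y} y∈ with y ∈? xs
  ... | yes y∈xs = y∈xs
  ... | no  y∉xs = contradiction (≤-trans (length-mono-⊆ u′ y∷xs⊆ys) len) 1+n≰n
    where
    u′ : Unique (y ∷ xs)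
    u′ = All.tabulate (λ p eq → y∉xs (subst (_∈ xs) (sym eq) p)) ∷ u
    y∷xs⊆ys : y ∷ xs ⊆ ys
    y∷xs⊆ys (here refl) = y∈
    y∷xs⊆ys (there p)   = xs⊆ys p

  -- A vertex `v` of `σ` outside `τ` prolongs `τ` to a repetition-free list in `σ` that is at least
  -- as long as `σ`, so no second vertex can be missing.
  ridge-vertex : ∀ {τ σ : List V} → Unique τ → τ ⊆ σ → length τ ≡ length σ ∸ 1 → ¬ σ ⊆ τ →
    ∃ λ v → v ∈ σ × v ∉ τ × (∀ {w} → w ∈ σ → w ≢ v → w ∈ τ)
  ridge-vertex {τ} {σ} uτ τ⊆σ len σ⊈τ with All.all? (_∈? τ) σ
  ... | yes σ⊆τ = ⊥-elim (σ⊈τ (All.lookup σ⊆τ))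
  ... | no ¬σ⊆τ with find (¬All⇒Any¬ (_∈? τ) σ ¬σ⊆τ)
  ... | v , v∈σ , v∉τ = v , v∈σ , v∉τ , rest
    where
    uv : Unique (v ∷ τ)
    uv = All.tabulate (λ p eq → v∉τ (subst (_∈ τ) (sym eq) p)) ∷ uτ

    v∷τ⊆σ : v ∷ τ ⊆ σ
    v∷τ⊆σ (here refl) = v∈σ
    v∷τ⊆σ (there p)   = τ⊆σ p

    -- The inequality, unlike an equation, also holds at `m = 0`, where `∸` truncates.
    pred≤ : ∀ m → m ≤ suc (m ∸ 1)
    pred≤ 0       = z≤n
    pred≤ (suc m) = ≤-refl

    rest : ∀ {w} → w ∈ σ → w ≢ v → w ∈ τ
    rest w∈σ w≢v with ⊆-length⇒⊇ uv v∷τ⊆σ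
      (subst (λ m → length σ ≤ suc m) (sym len) (pred≤ (length σ))) w∈σ
    ... | here eq = contradiction eq w≢v
    ... | there p = p

  -- Purity speaks of facets of the intersection, while `ρ ∩ σ` need not be one. Among the earlier
  -- facets whose meet with `σ` contains that of `ρ`, one with largest meet is chosen; this meet is
  -- a facet of the intersection, hence a ridge, and its missing vertex avoids `ρ`.
  shelling⇒exchange : ∀ {K : Complex V} {σs} → IsShelling K σs → ExchangeShelling K σs
  shelling⇒exchange {K} {σs} (fac , cov , dist , pure) = record
    { facets = fac ; cover = cov _ ; exchange = exch }
    where
    exch : ∀ {pre σ} → Initial pre σ σs → ∀ {ρ} → ρ ∈ pre → Exchange pre ρ σ
    exch {pre} {σ} s {ρ} ρ∈ = fromRidge
      (ridge-vertex (Uniqueₚ.filter⁺ (_∈? best) uσ) meet⊆σ len (λ σ⊆ → σ⊈ best∈ (meet⊆best ∘ σ⊆)))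
      where
      uσ : Unique σ
      uσ = proj₁ (All.lookup fac (initial-∈ s))

      meet : List V → List V
      meet α = filter (_∈? α) σ

      ⊆meet? : Decidable (λ α → All (_∈ meet α) (meet ρ))
      ⊆meet? α = All.all? (_∈? meet α) (meet ρ)

      candidates : List (List V)
      candidates = filter ⊆meet? pre

      best : List V
      best = argmax (length ∘ meet) ρ candidates

      -- The default value `ρ` of `argmax` satisfies both requirements as well.
      best-props : best ∈ pre × meet ρ ⊆ meet best
      best-props with argmax-sel (length ∘ meet) ρ candidates
      ... | inj₁ eq = subst (λ b → b ∈ pre × meet ρ ⊆ meet b) (sym eq) (ρ∈ , id)
      ... | inj₂ b∈ = let p , q = ∈-filter⁻ ⊆meet? {xs = pre} b∈ in p , All.lookup q

      meet⊆σ : meet best ⊆ σ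
      meet⊆σ = proj₁ ∘ ∈-filter⁻ (_∈? best) {xs = σ}

      meet⊆best : meet best ⊆ best
      meet⊆best = proj₂ ∘ ∈-filter⁻ (_∈? best) {xs = σ}

      best∈ : best ∈ pre
      best∈ = proj₁ best-props

      -- A facet `σ` inside an earlier facet would be the same set, against distinctness; so the
      -- meet is not all of `σ`.
      σ⊈ : ∀ {α} → α ∈ pre → ¬ σ ⊆ α
      σ⊈ α∈ σ⊆α = AllPairs⇒initial dist s α∈
        (proj₂ (proj₂ (All.lookup fac (initial-∈ s))) _
               (proj₁ (proj₂ (All.lookup fac (initial-⊆ s α∈)))) σ⊆α , σ⊆α)

      -- A face `τ` above the best meet lies in the meet with some earlier `α`, which is therefore a
      -- candidate and has no larger meet; equality follows by counting.
      maximal : ∀ τ → IntersectionComplex pre σ τ → meet best ⊆ τ → τ ⊆ meet best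
      maximal τ (τ⊆σ , α , α∈ , τ⊆α) b⊆τ w∈τ =
        ⊆-length⇒⊇ (Uniqueₚ.filter⁺ (_∈? best) uσ) (τ⊆meet ∘ b⊆τ)
          (All.lookup (f[xs]≤f[argmax] {f = length ∘ meet} ρ candidates)
            (∈-filter⁺ ⊆meet? α∈ (All.tabulate (τ⊆meet ∘ b⊆τ ∘ proj₂ best-props))))
          (τ⊆meet w∈τ)
        where
        τ⊆meet : τ ⊆ meet α
        τ⊆meet w∈τ = ∈-filter⁺ (_∈? α) (τ⊆σ w∈τ) (τ⊆α w∈τ)

      len : length (meet best) ≡ length σ ∸ 1
      len with initial⁻ s
      ... | post , eq = pure pre σ post eq (λ { refl → case ρ∈ of λ () }) (meet best)
        ( Uniqueₚ.filter⁺ (_∈? best) uσ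
        , (meet⊆σ , best , best∈ , meet⊆best)
        , maximal)

      fromRidge : (∃ λ v → v ∈ σ × v ∉ meet best × (∀ {w} → w ∈ σ → w ≢ v → w ∈ meet best)) →
                  Exchange pre ρ σ
      fromRidge (v , v∈σ , v∉ , rest) =
        v , v∈σ , (λ v∈ρ → v∉ (proj₂ best-props (∈-filter⁺ (_∈? ρ) v∈σ v∈ρ))) ,
        best , best∈ , (λ w∈ w≢ → meet⊆best (rest w∈ w≢))

  Shellable⇔ExchangeShellable : ∀ {K : Complex V} → Shellable K ⇔ ExchangeShellable K
  Shellable⇔ExchangeShellable = mk⇔ (λ (σs , S) → σs , shelling⇒exchange S)
                                    (λ (σs , E) → σs , exchange⇒shelling E)

  -- Enlarging faces greedily to facets.

  DownClosed : Complex V → Set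
  DownClosed K = ∀ {σ τ} → τ ⊆ σ → K σ → K τ

  module _ {K : Complex V} (K? : ∀ L → Dec (K L)) (down : DownClosed K) where

    -- Greedy pass over `vs`. A vertex rejected at its turn stays rejected, since the face only
    -- grows and `K` is closed downwards. Added vertices come from `vs` alone, which allows
    -- maximality among a prescribed set of vertices.
    saturate : ∀ vs {s} → Unique s → K s → ∃ λ τ →
      Unique τ × K τ × s ⊆ τ × (∀ {v} → v ∈ τ → v ∈ s ⊎ v ∈ vs) × (∀ {v} → v ∈ vs → K (v ∷ τ) → v ∈ τ)
    saturate [] u k = _ , u , k , id , inj₁ , λ ()
    saturate (x ∷ vs) {s} u k with x ∈? s
    ... | yes x∈s with saturate vs u k
    ...   | τ , uτ , kτ , s⊆τ , τ⊆ , sat = τ , uτ , kτ , s⊆τ , Sum.map₂ there ∘ τ⊆ ,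
            λ { (here refl) _ → s⊆τ x∈s ; (there p) → sat p }
    saturate (x ∷ vs) {s} u k | no x∉s with K? (x ∷ s)
    ... | no ¬k with saturate vs u k
    ...   | τ , uτ , kτ , s⊆τ , τ⊆ , sat = τ , uτ , kτ , s⊆τ , Sum.map₂ there ∘ τ⊆ ,
            λ { (here refl) k′ → contradiction (down (Subsetₚ.∷⁺ʳ x s⊆τ) k′) ¬k ; (there p) → sat p }
    saturate (x ∷ vs) {s} u k | no x∉s | yes k′
      with saturate vs (All.tabulate (λ p eq → x∉s (subst (_∈ s) (sym eq) p)) ∷ u) k′
    ...   | τ , uτ , kτ , s⊆τ , τ⊆ , sat = τ , uτ , kτ , s⊆τ ∘ there , back ∘ τ⊆ ,
            λ { (here refl) _ → s⊆τ (here refl) ; (there p) → sat p }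
      where
      back : ∀ {v} → v ∈ x ∷ s ⊎ v ∈ vs → v ∈ s ⊎ v ∈ x ∷ vs
      back (inj₁ (here eq)) = inj₂ (here eq)
      back (inj₁ (there p)) = inj₁ p
      back (inj₂ p)         = inj₂ (there p)

    extend-to-facet : ∀ {vs} → (∀ {L} → K L → L ⊆ vs) →
                      ∀ {s} → Unique s → K s → ∃ λ τ → IsFacet K τ × s ⊆ τ
    extend-to-facet {vs} verts u k with saturate vs u k
    ... | τ , uτ , kτ , s⊆τ , _ , sat = τ ,
      (uτ , kτ , λ σ kσ τ⊆σ v∈σ → sat (verts kσ v∈σ)
        (down (λ { (here refl) → v∈σ ; (there p) → τ⊆σ p }) kσ)) , s⊆τ

  -- Shellability passes to cones.

  module _ {K K′ : Complex V} (a : V)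
    (cone⁺ : ∀ {L} → K L → K′ (a ∷ L))
    (cone⁻ : ∀ {L M} → K′ L → M ⊆ L → a ∉ M → K M)
    (a-fresh : ∀ {L} → K L → a ∉ L) where

    private
      ≢a? : Decidable (_≢ a)
      ≢a? v = ¬? (v ≟ a)

      base : List V → List V
      base = filter ≢a?

      base⊆ : ∀ {L} → base L ⊆ L
      base⊆ {L} = proj₁ ∘ ∈-filter⁻ ≢a? {xs = L}

      a∉base : ∀ {L} → a ∉ base L
      a∉base {L} a∈ = proj₂ (∈-filter⁻ ≢a? {xs = L} a∈) refl

      ⊆a∷base : ∀ {L} → L ⊆ a ∷ base L
      ⊆a∷base {L} {v} v∈ with v ≟ a
      ... | yes refl = here refl
      ... | no  v≢a  = there (∈-filter⁺ ≢a? v∈ v≢a)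

      cone-base : ∀ {L} → K′ L → K (base L)
      cone-base {L} k = cone⁻ k (base⊆ {L}) (a∉base {L})

      ∷-mono : ∀ {L M : List V} → L ⊆ M → a ∷ L ⊆ a ∷ M
      ∷-mono = Subsetₚ.∷⁺ʳ a

      tail⊆ : ∀ {L M} → K L → (∀ {v} → v ∈ L → v ∈ M) → L ⊆ base M
      tail⊆ k L⊆M v∈ = ∈-filter⁺ ≢a? (L⊆M v∈) λ { refl → a-fresh k v∈ }

      facet⁺ : ∀ {σ} → IsFacet K σ → IsFacet K′ (a ∷ σ)
      facet⁺ {σ} (u , k , maximal) =
        All.tabulate (λ p eq → a-fresh k (subst (_∈ σ) (sym eq) p)) ∷ u , cone⁺ k ,
        λ L kL a∷σ⊆L → ∷-mono (maximal (base L) (cone-base kL) (tail⊆ k (a∷σ⊆L ∘ there))) ∘ ⊆a∷base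

      apex∈ : ∀ {σ} → IsFacet K′ σ → a ∈ σ
      apex∈ (u , k , maximal) = maximal _ (cone⁺ (cone-base k)) ⊆a∷base (here refl)

      facet⁻ : ∀ {σ} → IsFacet K′ σ → IsFacet K (base σ)
      facet⁻ {σ} (u , k , maximal) = Uniqueₚ.filter⁺ ≢a? u , cone-base k ,
        λ M kM base⊆M → tail⊆ kM (maximal (a ∷ M) (cone⁺ kM) (∷-mono base⊆M ∘ ⊆a∷base) ∘ there)

    -- Every facet of `K′` is a facet of `K` with `a` added, and since all of them share `a`, each
    -- exchange takes place inside `K`.
    cone-shellable : ExchangeShellable K → ExchangeShellable K′
    cone-shellable (σs , E) = map (a ∷_) σs , record
      { facets   = All.tabulate fac
      ; cover    = cov
      ; exchange = exch }
      where
      fac : ∀ {σ} → σ ∈ map (a ∷_) σs → IsFacet K′ σ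
      fac σ∈ with ∈-map⁻ (a ∷_) σ∈
      ... | σ₀ , σ₀∈ , refl = facet⁺ (All.lookup (facets E) σ₀∈)

      cov : ∀ {σ} → IsFacet K′ σ → ∃ λ ρ → ρ ∈ map (a ∷_) σs × SameSet σ ρ
      cov F with cover E (facet⁻ F)
      ... | ρ , ρ∈ , σ⊆ρ , ρ⊆σ = a ∷ ρ , ∈-map⁺ (a ∷_) ρ∈ , ∷-mono σ⊆ρ ∘ ⊆a∷base ,
        λ { (here refl) → apex∈ F ; (there p) → base⊆ (ρ⊆σ p) }

      exch : ∀ {pre σ} → Initial pre σ (map (a ∷_) σs) → ∀ {ρ} → ρ ∈ pre → Exchange pre ρ σ
      exch s ρ∈ with initial-map⁻ (a ∷_) σs s
      ... | pre′ , σ , s′ , refl , refl with ∈-map⁻ (a ∷_) ρ∈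
      ... | ρ , ρ∈′ , refl with exchange E s′ ρ∈′
      ... | v , v∈σ , v∉ρ , ρ′ , ρ′∈ , rest = v , there v∈σ ,
        (λ { (here refl) → a-fresh (proj₁ (proj₂ (All.lookup (facets E) (initial-∈ s′)))) v∈σ
           ; (there p) → v∉ρ p }) ,
        a ∷ ρ′ , ∈-map⁺ (a ∷_) ρ′∈ ,
        λ { (here refl) _ → here refl ; (there p) w≢ → there (rest p w≢) }

-- Links of shellable complexes.

Unique-map : ∀ {A B : Set} {f : A → B} {xs} →
  (∀ {x y} → x ∈ xs → y ∈ xs → f x ≡ f y → x ≡ y) → Unique xs → Unique (map f xs)
Unique-map inj []       = []
Unique-map {f = f} inj (x≢ ∷ u) =
  All.tabulate (λ p eq → let y , y∈ , y≡ = ∈-map⁻ f p in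
                         All.lookup x≢ y∈ (inj (here refl) (there y∈) (trans eq y≡)))
  ∷ Unique-map (λ p q → inj (there p) (there q)) u

-- Up to relabelling vertices along φ, K′ is the link of the face τ in K, and ws lists the vertices of K′.
module Link {V W : Set} (_≟_ : DecidableEquality V)
  {K : Complex V} {K′ : Complex W} (φ : W → V) {τ : List V} (τ! : Unique τ)
  {ws : List W} (ws! : Unique ws)
  (φ-injective : ∀ {w w′} → w ∈ ws → w′ ∈ ws → φ w ≡ φ w′ → w ≡ w′)
  (vertices : ∀ {L} → K′ L → L ⊆ ws)
  (fresh : ∀ {w} → w ∈ ws → φ w ∉ τ)
  (join : ∀ {L} → K′ L → K (map φ L ++ τ))
  (restrict : ∀ {σ L} → K σ → τ ⊆ σ → (∀ {w} → w ∈ L → w ∈ ws × φ w ∈ σ) → K′ L)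
  (covered : ∀ {σ v} → K σ → τ ⊆ σ → v ∈ σ → v ∈ τ ⊎ ∃ λ w → w ∈ ws × v ≡ φ w)
  where
  open DecMembership _≟_ using (_∈?_)

  private
    inσ? : ∀ σ → Decidable (λ w → φ w ∈ σ)
    inσ? σ w = φ w ∈? σ

    res : List V → List W
    res σ = filter (inσ? σ) ws

    res⁻ : ∀ {σ w} → w ∈ res σ → w ∈ ws × φ w ∈ σ
    res⁻ {σ} = ∈-filter⁻ (inσ? σ)

    res⁺ : ∀ {σ w} → w ∈ ws → φ w ∈ σ → w ∈ res σ
    res⁺ {σ} = ∈-filter⁺ (inσ? σ)

    split : ∀ {σ v} → K σ → τ ⊆ σ → v ∈ σ → v ∈ τ ⊎ ∃ λ w → w ∈ res σ × v ≡ φ w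
    split k τ⊆σ v∈σ with covered k τ⊆σ v∈σ
    ... | inj₁ v∈τ             = inj₁ v∈τ
    ... | inj₂ (w , w∈ , refl) = inj₂ (w , res⁺ w∈ v∈σ , refl)

    joined : ∀ {L σ} → map φ L ++ τ ⊆ σ → ∀ {w} → w ∈ L → φ w ∈ σ
    joined L⊆σ w∈ = L⊆σ (∈-++⁺ˡ (∈-map⁺ φ w∈))

    facet-res : ∀ {σ} → IsFacet K σ → τ ⊆ σ → IsFacet K′ (res σ)
    facet-res {σ} (u , k , maximal) τ⊆σ =
      Uniqueₚ.filter⁺ (inσ? σ) ws! , restrict k τ⊆σ res⁻ , max
      where
      max : ∀ L → K′ L → res σ ⊆ L → L ⊆ res σ
      max L kL res⊆L w∈ = res⁺ (vertices kL w∈) (joined (maximal _ (join kL) σ⊆) w∈)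
        where
        σ⊆ : σ ⊆ map φ L ++ τ
        σ⊆ v∈ with split k τ⊆σ v∈
        ... | inj₁ v∈τ             = ∈-++⁺ʳ (map φ L) v∈τ
        ... | inj₂ (w , w∈ , refl) = ∈-++⁺ˡ (∈-map⁺ φ (res⊆L w∈))

    facet-join : ∀ {L} → IsFacet K′ L → IsFacet K (map φ L ++ τ)
    facet-join {L} (u , k , maximal) =
      Uniqueₚ.++⁺ (Unique-map (λ p q → φ-injective (vertices k p) (vertices k q)) u) τ! disjoint ,
      join k , max
      where
      disjoint : Disjoint (map φ L) τ
      disjoint (p , q) with ∈-map⁻ φ p
      ... | w , w∈ , refl = fresh (vertices k w∈) q

      max : ∀ σ → K σ → map φ L ++ τ ⊆ σ → σ ⊆ map φ L ++ τ
      max σ kσ L⊆σ v∈ with split kσ (L⊆σ ∘ ∈-++⁺ʳ (map φ L)) v∈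
      ... | inj₁ v∈τ             = ∈-++⁺ʳ (map φ L) v∈τ
      ... | inj₂ (w , w∈ , refl) = ∈-++⁺ˡ (∈-map⁺ φ
        (maximal (res σ) (restrict kσ (L⊆σ ∘ ∈-++⁺ʳ (map φ L)) res⁻)
          (λ w∈ → res⁺ (vertices k w∈) (joined L⊆σ w∈)) w∈))

    ⊇τ? : Decidable (λ σ → All (_∈ σ) τ)
    ⊇τ? σ = All.all? (_∈? σ) τ

  -- Two facets containing `τ` are exchanged at a vertex outside `τ`, and the earlier facet `ρ′`
  -- that contains the ridge again contains `τ`. The exchange thus stays among the facets in `star`
  -- and restricts to `K′`.
  link-shellable : ExchangeShellable K → ExchangeShellable K′
  link-shellable (σs , E) = map res star , record
    { facets = All.tabulate fac ; cover = cov ; exchange = exch }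
    where
    star : List (List V)
    star = filter ⊇τ? σs

    star⁻ : ∀ {σ} → σ ∈ star → IsFacet K σ × τ ⊆ σ
    star⁻ σ∈ = let p , q = ∈-filter⁻ ⊇τ? {xs = σs} σ∈ in All.lookup (facets E) p , All.lookup q

    fac : ∀ {L} → L ∈ map res star → IsFacet K′ L
    fac L∈ with ∈-map⁻ res L∈
    ... | σ , σ∈ , refl = let F , τ⊆σ = star⁻ σ∈ in facet-res F τ⊆σ

    cov : ∀ {L} → IsFacet K′ L → ∃ λ ρ → ρ ∈ map res star × SameSet L ρ
    cov {L} F@(_ , k , _) with cover E (facet-join F)
    ... | σ , σ∈ , L⊆σ , σ⊆L =
      res σ , ∈-map⁺ res (∈-filter⁺ ⊇τ? σ∈ (All.tabulate (L⊆σ ∘ ∈-++⁺ʳ (map φ L)))) ,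
      (λ w∈ → res⁺ (vertices k w∈) (joined L⊆σ w∈)) , back
      where
      back : res σ ⊆ L
      back w∈ with res⁻ {σ} w∈
      ... | w∈ws , φw∈ with ∈-++⁻ (map φ L) (σ⊆L φw∈)
      ... | inj₂ ∈τ = contradiction ∈τ (fresh w∈ws)
      ... | inj₁ p with ∈-map⁻ φ p
      ... | w′ , w′∈ , eq = subst (_∈ L) (sym (φ-injective w∈ws (vertices k w′∈) eq)) w′∈

    exch : ∀ {pre L} → Initial pre L (map res star) → ∀ {ρ} → ρ ∈ pre → Exchange pre ρ L
    exch s ρ∈ with initial-map⁻ res star s
    ... | pre₁ , σ , s₁ , refl , refl with initial-filter⁻ ⊇τ? σs s₁ | ∈-map⁻ res ρ∈
    ... | pre₂ , s₂ , refl | ρ , ρ∈₁ , refl with ∈-filter⁻ ⊇τ? {xs = pre₂} ρ∈₁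
    ... | ρ∈₂ , τ⊆ρ with exchange E s₂ ρ∈₂ | star⁻ (initial-∈ s₁)
    ... | v , v∈σ , v∉ρ , ρ′ , ρ′∈ , rest | (_ , k , _) , τ⊆σ with split k τ⊆σ v∈σ
    ... | inj₁ v∈τ = contradiction (All.lookup τ⊆ρ v∈τ) v∉ρ
    ... | inj₂ (w , w∈ , refl) = w , w∈ , (λ w∈ρ → v∉ρ (proj₂ (res⁻ {ρ} w∈ρ))) ,
      res ρ′ ,
      ∈-map⁺ res (∈-filter⁺ ⊇τ? ρ′∈
        (All.tabulate (λ t∈ → rest (τ⊆σ t∈) λ { refl → v∉ρ (All.lookup τ⊆ρ t∈) }))) ,
      λ u∈ u≢w → let u∈ws , φu∈ = res⁻ {σ} u∈ in
        res⁺ u∈ws (rest φu∈ (λ eq → u≢w (φ-injective u∈ws (proj₁ (res⁻ {σ} w∈)) eq)))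

-- Subsets of a finite set and complexes of chains.

_≟ˢ_ : ∀ {n} → DecidableEquality (Subset n)
_≟ˢ_ = Vecₚ.≡-dec Bool._≟_

subsets : ∀ n → List (Subset n)
subsets 0       = [] ∷ []
subsets (suc n) = map (true ∷_) (subsets n) ++ map (false ∷_) (subsets n)

∈-subsets : ∀ {n} (A : Subset n) → A ∈ subsets n
∈-subsets []          = here refl
∈-subsets (true ∷ A)  = ∈-++⁺ˡ (∈-map⁺ (true ∷_) (∈-subsets A))
∈-subsets (false ∷ A) = ∈-++⁺ʳ (map (true ∷_) (subsets _)) (∈-map⁺ (false ∷_) (∈-subsets A))

subsets! : ∀ n → Unique (subsets n)
subsets! 0       = [] ∷ []
subsets! (suc n) = Uniqueₚ.++⁺ (Uniqueₚ.map⁺ Vecₚ.∷-injectiveʳ (subsets! n))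
  (Uniqueₚ.map⁺ Vecₚ.∷-injectiveʳ (subsets! n)) disjoint
  where
  disjoint : Disjoint (map (true ∷_) (subsets n)) (map (false ∷_) (subsets n))
  disjoint (p , q) with ∈-map⁻ (true ∷_) p | ∈-map⁻ (false ∷_) q
  ... | _ , _ , refl | _ , _ , ()

⊈⇒∃ : ∀ {n} {A B : Subset n} → ¬ A ⊆ˢ B → ∃ λ x → x ∈ˢ A × x ∉ˢ B
⊈⇒∃ {A = A} {B} A⊈B with Fin.any? (λ x → (x ∈ˢ? A) ×-dec ¬? (x ∈ˢ? B))
... | yes e  = e
... | no  ¬e = ⊥-elim (A⊈B A⊆B)
  where
  A⊆B : A ⊆ˢ B
  A⊆B {x} x∈A with x ∈ˢ? B
  ... | yes x∈B = x∈B
  ... | no  x∉B = contradiction (x , x∈A , x∉B) ¬e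

⊆∧≢⇒⊂ : ∀ {n} {A B : Subset n} → A ⊆ˢ B → A ≢ B → A ⊂ˢ B
⊆∧≢⇒⊂ A⊆B A≢B = A⊆B , ⊈⇒∃ (λ B⊆A → A≢B (⊆-antisym A⊆B B⊆A))

⊂⇒≢ : ∀ {n} {A B : Subset n} → A ⊂ˢ B → A ≢ B
⊂⇒≢ (_ , x , x∈B , x∉A) refl = x∉A x∈B

≢⊤⇒⊂⊤ : ∀ {n} {A : Subset n} → A ≢ ⊤ → A ⊂ˢ ⊤
≢⊤⇒⊂⊤ = ⊆∧≢⇒⊂ ⊆⊤

-- The order complex of a family of sets under inclusion. `Bergman cl` unfolds to the case
-- `P = Between cl (cl ⊥)`, so the results on chains apply to it as they stand.
ChainComplex : ∀ {n} → (Subset n → Set) → Complex (Subset n)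
ChainComplex P L = All P L × (∀ F G → F ∈ L → G ∈ L → F ⊆ˢ G ⊎ G ⊆ˢ F)

module _ {n} {P : Subset n → Set} where

  chain-down : DownClosed _≟ˢ_ (ChainComplex P)
  chain-down τ⊆σ (ps , total) =
    All.tabulate (All.lookup ps ∘ τ⊆σ) , λ F G F∈ G∈ → total F G (τ⊆σ F∈) (τ⊆σ G∈)

  chain? : Decidable P → ∀ L → Dec (ChainComplex P L)
  chain? P? L = All.all? P? L ×-dec Dec.map′
    (λ a F G F∈ G∈ → All.lookup (All.lookup a F∈) G∈)
    (λ t → All.tabulate λ F∈ → All.tabulate λ G∈ → t _ _ F∈ G∈)
    (All.all? (λ F → All.all? (λ G → (F ⊆ˢ? G) ⊎-dec (G ⊆ˢ? F)) L) L)

  vertices-of : (P? : Decidable P) → ∀ {L} → ChainComplex P L → L ⊆ filter P? (subsets n)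
  vertices-of P? (ps , _) G∈ = ∈-filter⁺ P? (∈-subsets _) (All.lookup ps G∈)

  vertex⁻ : (P? : Decidable P) → ∀ {G} → G ∈ filter P? (subsets n) → P G
  vertex⁻ P? = proj₂ ∘ ∈-filter⁻ P? {xs = subsets n}

module _ {m n} {P : Subset m → Set} {Q : Subset n → Set} (P? : Decidable P)
  (φ : Subset m → Subset n) (ψ : Subset n → Subset m)
  (φ-mono : ∀ {A B} → A ⊆ˢ B → φ A ⊆ˢ φ B) (ψ-mono : ∀ {A B} → A ⊆ˢ B → ψ A ⊆ˢ ψ B)
  (φ⁺ : ∀ {A} → P A → Q (φ A)) (ψ⁺ : ∀ {B} → Q B → P (ψ B))
  (ψφ : ∀ {A} → P A → ψ (φ A) ≡ A) (φψ : ∀ {B} → Q B → φ (ψ B) ≡ B)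
  where

  -- An order isomorphism is handled as the link of the empty face, with `φ` as the relabelling of
  -- vertices.
  chain-iso-shellable : ExchangeShellable (ChainComplex Q) → ExchangeShellable (ChainComplex P)
  chain-iso-shellable = Link.link-shellable _≟ˢ_ φ [] (Uniqueₚ.filter⁺ P? (subsets! m))
    φ-inj (vertices-of P?) (λ _ ()) join restrict covered
    where
    ws : List (Subset m)
    ws = filter P? (subsets m)

    φ-inj : ∀ {A B} → A ∈ ws → B ∈ ws → φ A ≡ φ B → A ≡ B
    φ-inj A∈ B∈ eq = trans (sym (ψφ (vertex⁻ P? A∈))) (trans (cong ψ eq) (ψφ (vertex⁻ P? B∈)))

    image : ∀ {L B} → B ∈ map φ L ++ [] → ∃ λ A → A ∈ L × B ≡ φ A
    image {L} B∈ with ∈-++⁻ (map φ L) B∈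
    ... | inj₁ p = ∈-map⁻ φ p

    join : ∀ {L} → ChainComplex P L → ChainComplex Q (map φ L ++ [])
    join {L} (ps , total) = All.tabulate fac , tot
      where
      fac : ∀ {B} → B ∈ map φ L ++ [] → Q B
      fac B∈ with image B∈
      ... | A , A∈ , refl = φ⁺ (All.lookup ps A∈)
      tot : ∀ F G → F ∈ map φ L ++ [] → G ∈ map φ L ++ [] → F ⊆ˢ G ⊎ G ⊆ˢ F
      tot F G F∈ G∈ with image F∈ | image G∈
      ... | A , A∈ , refl | B , B∈ , refl = Sum.map φ-mono φ-mono (total A B A∈ B∈)

    restrict : ∀ {σ L} → ChainComplex Q σ → [] ⊆ σ → (∀ {w} → w ∈ L → w ∈ ws × φ w ∈ σ) →
               ChainComplex P L
    restrict {σ} {L} (_ , total) _ L⊆ =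
      All.tabulate (λ A∈ → vertex⁻ P? (proj₁ (L⊆ A∈))) , tot
      where
      back : ∀ {A B} → A ∈ L → B ∈ L → φ A ⊆ˢ φ B → A ⊆ˢ B
      back A∈ B∈ le = subst₂ _⊆ˢ_ (ψφ (vertex⁻ P? (proj₁ (L⊆ A∈)))) (ψφ (vertex⁻ P? (proj₁ (L⊆ B∈))))
                                  (ψ-mono le)
      tot : ∀ F G → F ∈ L → G ∈ L → F ⊆ˢ G ⊎ G ⊆ˢ F
      tot F G F∈ G∈ = Sum.map (back F∈ G∈) (back G∈ F∈)
        (total (φ F) (φ G) (proj₂ (L⊆ F∈)) (proj₂ (L⊆ G∈)))

    covered : ∀ {σ B} → ChainComplex Q σ → [] ⊆ σ → B ∈ σ → B ∈ [] ⊎ ∃ λ A → A ∈ ws × B ≡ φ A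
    covered {B = B} (qs , _) _ B∈ =
      inj₂ (ψ B , ∈-filter⁺ P? (∈-subsets _) (ψ⁺ (All.lookup qs B∈)) , sym (φψ (All.lookup qs B∈)))

-- Intervals of flats as links in the Bergman complex.

module _ {n} (f : Subset n → Subset n) where

  Between : Subset n → Subset n → Set
  Between F G = IsFlat f G × F ⊂ˢ G × G ⊂ˢ ⊤

  -- The half-open interval from `F` to `E`, without `E`; for `F = cl I` it holds the flats that may
  -- accompany `I` in a face of the augmented complex.
  AtLeast : Subset n → Subset n → Set
  AtLeast F G = IsProperFlat f G × F ⊆ˢ G

  between? : ∀ F → Decidable (Between F)
  between? F G = (f G ≟ˢ G) ×-dec (F ⊂ˢ? G) ×-dec (G ⊂ˢ? ⊤)

  atLeast? : ∀ F → Decidable (AtLeast F)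
  atLeast? F G = ((f G ≟ˢ G) ×-dec ¬? (G ≟ˢ ⊤)) ×-dec (F ⊆ˢ? G)

module _ {n} (f : ClosureOperator n) where
  open ClosureOperator f

  -- Here `τ` is a chain of flats contained in `F`, maximal among these and containing `F` as a
  -- member unless `F` is `cl ⊥`. A flat in a face above `τ` is comparable with `F`: either it lies
  -- inside `F` and maximality puts it in `τ`, or it lies strictly above `F`.
  interval-shellable : ∀ {F} → IsProperFlat cl F → ExchangeShellable (Bergman cl) →
                       ExchangeShellable (ChainComplex (Between cl F))
  interval-shellable {F} (flatF , F≢⊤) = Link.link-shellable _≟ˢ_ id τ!
    (Uniqueₚ.filter⁺ P? (subsets! n)) (λ _ _ eq → eq) (vertices-of P?) fresh join restrict covered
    where
    P? : Decidable (Between cl F)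
    P? = between? cl F

    ws : List (Subset n)
    ws = filter P? (subsets n)

    below : List (Subset n)
    below = filter (_⊆ˢ? F) (subsets n)

    cl⊥⊆F : cl ⊥ ⊆ˢ F
    cl⊥⊆F = subst (cl ⊥ ⊆ˢ_) flatF (monotone ⊥⊆)

    -- When `F` is `cl ⊥` it is not a vertex of the Bergman complex, and the chain starts empty.
    start : ∃ λ s → Unique s × Bergman cl s × s ⊆ F ∷ [] × (cl ⊥ ≢ F → F ∈ s)
    start with cl ⊥ ≟ˢ F
    ... | yes eq = [] , [] , ([] , λ _ _ ()) , (λ ()) , contradiction eq
    ... | no  ne = F ∷ [] , [] ∷ [] ,
      ((flatF , ⊆∧≢⇒⊂ cl⊥⊆F ne , ≢⊤⇒⊂⊤ F≢⊤) ∷ [] , λ { _ _ (here refl) (here refl) → inj₁ id }) ,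
      id , (λ _ → here refl)

    saturated = let s , s! , k , _ = start in
      saturate _≟ˢ_ {K = Bergman cl} (chain? (between? cl (cl ⊥))) chain-down below s! k

    τ : List (Subset n)
    τ = proj₁ saturated

    τ! : Unique τ
    τ! = proj₁ (proj₂ saturated)

    Kτ : Bergman cl τ
    Kτ = proj₁ (proj₂ (proj₂ saturated))

    τ⊆F : ∀ {G} → G ∈ τ → G ⊆ˢ F
    τ⊆F G∈ with proj₁ (proj₂ (proj₂ (proj₂ (proj₂ saturated)))) G∈
    ... | inj₂ G∈below = proj₂ (∈-filter⁻ (_⊆ˢ? F) {xs = subsets n} G∈below)
    ... | inj₁ G∈s with proj₁ (proj₂ (proj₂ (proj₂ start))) G∈s
    ...   | here refl = id

    F∈τ : cl ⊥ ≢ F → F ∈ τ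
    F∈τ ne = proj₁ (proj₂ (proj₂ (proj₂ saturated))) (proj₂ (proj₂ (proj₂ (proj₂ start))) ne)

    maximal : ∀ {G} → G ⊆ˢ F → Bergman cl (G ∷ τ) → G ∈ τ
    maximal G⊆F = proj₂ (proj₂ (proj₂ (proj₂ (proj₂ saturated))))
      (∈-filter⁺ (_⊆ˢ? F) (∈-subsets _) G⊆F)

    fresh : ∀ {G} → G ∈ ws → G ∉ τ
    fresh G∈ G∈τ with vertex⁻ P? G∈
    ... | _ , (_ , x , x∈G , x∉F) , _ = x∉F (τ⊆F G∈τ x∈G)

    join : ∀ {L} → ChainComplex (Between cl F) L → Bergman cl (map id L ++ τ)
    join {L} (ps , total) = All.tabulate fac , tot
      where
      either : ∀ {G} → G ∈ map id L ++ τ → G ∈ L ⊎ G ∈ τ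
      either {G} G∈ with ∈-++⁻ (map id L) G∈
      ... | inj₂ q = inj₂ q
      ... | inj₁ p with ∈-map⁻ id p
      ...   | _ , q , refl = inj₁ q
      fac : ∀ {G} → G ∈ map id L ++ τ → Between cl (cl ⊥) G
      fac G∈ with either G∈
      ... | inj₁ p = let flat , F⊂G , G⊂⊤ = All.lookup ps p in flat , ⊆-⊂-trans cl⊥⊆F F⊂G , G⊂⊤
      ... | inj₂ p = All.lookup (proj₁ Kτ) p
      over : ∀ {G H} → G ∈ τ → H ∈ L → G ⊆ˢ H
      over G∈ H∈ = ⊆-trans (τ⊆F G∈) (proj₁ (proj₁ (proj₂ (All.lookup ps H∈))))
      tot : ∀ G H → G ∈ map id L ++ τ → H ∈ map id L ++ τ → G ⊆ˢ H ⊎ H ⊆ˢ G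
      tot G H G∈ H∈ with either G∈ | either H∈
      ... | inj₁ p | inj₁ q = total G H p q
      ... | inj₁ p | inj₂ q = inj₂ (over q p)
      ... | inj₂ p | inj₁ q = inj₁ (over p q)
      ... | inj₂ p | inj₂ q = proj₂ Kτ G H p q

    restrict : ∀ {σ L} → Bergman cl σ → τ ⊆ σ → (∀ {G} → G ∈ L → G ∈ ws × G ∈ σ) →
               ChainComplex (Between cl F) L
    restrict (_ , total) _ L⊆ = All.tabulate (λ G∈ → vertex⁻ P? (proj₁ (L⊆ G∈))) ,
      λ G H G∈ H∈ → total G H (proj₂ (L⊆ G∈)) (proj₂ (L⊆ H∈))

    covered : ∀ {σ G} → Bergman cl σ → τ ⊆ σ → G ∈ σ → G ∈ τ ⊎ ∃ λ H → H ∈ ws × G ≡ H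
    covered {σ} {G} kσ@(ps , total) τ⊆σ G∈ with G ⊆ˢ? F
    ... | yes G⊆F = inj₁ (maximal G⊆F
      (chain-down (λ { (here refl) → G∈ ; (there p) → τ⊆σ p }) kσ))
    ... | no  G⊈F = let flat , cl⊥⊂G , G⊂⊤ = All.lookup ps G∈ in
      inj₂ (G , ∈-filter⁺ P? (∈-subsets G) (flat , (F⊆G (proj₁ cl⊥⊂G) , ⊈⇒∃ G⊈F) , G⊂⊤) , refl)
      where
      F⊆G : cl ⊥ ⊆ˢ G → F ⊆ˢ G
      F⊆G cl⊥⊆G = by-cases (cl ⊥ ≟ˢ F)
        where
        by-cases : Dec (cl ⊥ ≡ F) → F ⊆ˢ G
        by-cases (yes refl) = cl⊥⊆G
        by-cases (no ne) with total F G (τ⊆σ (F∈τ ne)) G∈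
        ... | inj₁ le = le
        ... | inj₂ ge = ⊥-elim (G⊈F ge)

-- Contractions and the interval above a flat.

lookup-injective : ∀ {A : Set} {xs : List A} → Unique xs →
                   ∀ {i j} → List.lookup xs i ≡ List.lookup xs j → i ≡ j
lookup-injective (x≢ ∷ u) {zero}  {zero}  eq = refl
lookup-injective (x≢ ∷ u) {zero}  {suc j} eq = contradiction eq (All.lookup x≢ (∈-lookup j))
lookup-injective (x≢ ∷ u) {suc i} {zero}  eq = contradiction (sym eq) (All.lookup x≢ (∈-lookup i))
lookup-injective (x≢ ∷ u) {suc i} {suc j} eq = cong suc (lookup-injective u eq)

∈-tabulateˢ⁺ : ∀ {n} (g : Fin n → Bool) {i} → T (g i) → i ∈ˢ Vec.tabulate g
∈-tabulateˢ⁺ g {i} t = Vecₚ.lookup⇒[]= i _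
  (trans (Vecₚ.lookup∘tabulate g i) (Equivalence.to Boolₚ.T-≡ t))

∈-tabulateˢ⁻ : ∀ {n} (g : Fin n → Bool) {i} → i ∈ˢ Vec.tabulate g → T (g i)
∈-tabulateˢ⁻ g {i} i∈ = Equivalence.from Boolₚ.T-≡
  (trans (sym (Vecₚ.lookup∘tabulate g i)) (Vecₚ.[]=⇒lookup i∈))

∈⇔T-lookup : ∀ {n} {A : Subset n} {i} → i ∈ˢ A ⇔ T (Vec.lookup A i)
∈⇔T-lookup = mk⇔ (Equivalence.from Boolₚ.T-≡ ∘ Vecₚ.[]=⇒lookup)
                 (Vecₚ.lookup⇒[]= _ _ ∘ Equivalence.to Boolₚ.T-≡)

module Complement {n} (F : Subset n) where

  ∈-liftSub⁺ : ∀ {A j} → j ∈ˢ A → ι F j ∈ˢ liftSub F A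
  ∈-liftSub⁺ {A} {j} j∈A = ∈-tabulateˢ⁺ _ (Anyₚ.any⁺ _
    (lose (∈-allFin j) (Equivalence.from Boolₚ.T-∧ (Equivalence.to ∈⇔T-lookup j∈A , fromWitness refl))))

  ∈-liftSub⁻ : ∀ {A i} → i ∈ˢ liftSub F A → ∃ λ j → j ∈ˢ A × ι F j ≡ i
  ∈-liftSub⁻ {A} i∈ with find (Anyₚ.any⁻ _ (allFin (cardCompl F)) (∈-tabulateˢ⁻ _ i∈))
  ... | j , _ , t = let p , q = Equivalence.to Boolₚ.T-∧ t in
    j , Equivalence.from (∈⇔T-lookup {A = A}) p , toWitness q

  ι∉ : ∀ j → ι F j ∉ˢ F
  ι∉ j = proj₂ (∈-filter⁻ (λ i → ¬? (i ∈ˢ? F)) {xs = allFin n} (∈-lookup j))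

  ι-surjective : ∀ {i} → i ∉ˢ F → ∃ λ j → ι F j ≡ i
  ι-surjective {i} i∉F = Any.index i∈ , sym (Anyₚ.lookup-index i∈)
    where
    i∈ : i ∈ complementList F
    i∈ = ∈-filter⁺ (λ i → ¬? (i ∈ˢ? F)) (∈-allFin i) i∉F

  ι-injective : ∀ {j k} → ι F j ≡ ι F k → j ≡ k
  ι-injective = lookup-injective (Uniqueₚ.filter⁺ (λ i → ¬? (i ∈ˢ? F)) (Uniqueₚ.allFin⁺ n))

  -- A ↦ A ∪ F and G ↦ G ∖ F, between subsets of E ∖ F and subsets of E containing F.
  join : Subset (cardCompl F) → Subset n
  join A = liftSub F A ∪ F

  drop : Subset n → Subset (cardCompl F)
  drop G = Vec.tabulate (λ j → Vec.lookup G (ι F j))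

  ∈-drop⁺ : ∀ {G j} → ι F j ∈ˢ G → j ∈ˢ drop G
  ∈-drop⁺ = ∈-tabulateˢ⁺ _ ∘ Equivalence.to ∈⇔T-lookup

  ∈-drop⁻ : ∀ {G j} → j ∈ˢ drop G → ι F j ∈ˢ G
  ∈-drop⁻ = Equivalence.from ∈⇔T-lookup ∘ ∈-tabulateˢ⁻ _

  F⊆join : ∀ A → F ⊆ˢ join A
  F⊆join A = q⊆p∪q (liftSub F A) F

  ∈-join⁺ : ∀ {A j} → j ∈ˢ A → ι F j ∈ˢ join A
  ∈-join⁺ j∈A = x∈p∪q⁺ (inj₁ (∈-liftSub⁺ j∈A))

  ∈-join⁻ : ∀ {A i} → i ∈ˢ join A → i ∈ˢ F ⊎ ∃ λ j → j ∈ˢ A × ι F j ≡ i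
  ∈-join⁻ {A} i∈ = Sum.swap (Sum.map₁ ∈-liftSub⁻ (x∈p∪q⁻ (liftSub F A) F i∈))

  ι∈join⁻ : ∀ {A j} → ι F j ∈ˢ join A → j ∈ˢ A
  ι∈join⁻ {A} {j} i∈ with ∈-join⁻ {A} i∈
  ... | inj₁ i∈F            = contradiction i∈F (ι∉ j)
  ... | inj₂ (k , k∈A , eq) = subst (_∈ˢ A) (ι-injective eq) k∈A

  drop-join : ∀ A → drop (join A) ≡ A
  drop-join A = ⊆-antisym (ι∈join⁻ ∘ ∈-drop⁻) (∈-drop⁺ ∘ ∈-join⁺)

  join-drop : ∀ {G} → F ⊆ˢ G → join (drop G) ≡ G
  join-drop {G} F⊆G = ⊆-antisym to from
    where
    to : join (drop G) ⊆ˢ G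
    to i∈ with ∈-join⁻ {drop G} i∈
    ... | inj₁ i∈F              = F⊆G i∈F
    ... | inj₂ (j , j∈ , refl) = ∈-drop⁻ j∈
    from : G ⊆ˢ join (drop G)
    from {i} i∈ with i ∈ˢ? F
    ... | yes i∈F = F⊆join (drop G) i∈F
    ... | no  i∉F with ι-surjective i∉F
    ...   | j , refl = ∈-join⁺ (∈-drop⁺ i∈)

  join-mono : ∀ {A B} → A ⊆ˢ B → join A ⊆ˢ join B
  join-mono {A} {B} A⊆B i∈ with ∈-join⁻ {A} i∈
  ... | inj₁ i∈F             = F⊆join B i∈F
  ... | inj₂ (j , j∈ , refl) = ∈-join⁺ (A⊆B j∈)

  drop-mono : ∀ {G H} → G ⊆ˢ H → drop G ⊆ˢ drop H
  drop-mono G⊆H = ∈-drop⁺ ∘ G⊆H ∘ ∈-drop⁻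

  join-mono-⊂ : ∀ {A B} → A ⊂ˢ B → join A ⊂ˢ join B
  join-mono-⊂ (A⊆B , j , j∈B , j∉A) = join-mono A⊆B , ι F j , ∈-join⁺ j∈B , j∉A ∘ ι∈join⁻

  drop-mono-⊂ : ∀ {G H} → F ⊆ˢ G → G ⊂ˢ H → drop G ⊂ˢ drop H
  drop-mono-⊂ F⊆G (G⊆H , i , i∈H , i∉G) with ι-surjective (i∉G ∘ F⊆G)
  ... | j , refl = drop-mono G⊆H , j , ∈-drop⁺ i∈H , i∉G ∘ ∈-drop⁻

module _ {n} (f : ClosureOperator n) (F : Subset n) (flatF : IsFlat (ClosureOperator.cl f) F) where
  open ClosureOperator f
  open Complement F

  private
    join⊥ : join ⊥ ≡ F
    join⊥ = ⊆-antisym sub (F⊆join ⊥)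
      where
      sub : join ⊥ ⊆ˢ F
      sub i∈ with ∈-join⁻ {A = ⊥} i∈
      ... | inj₁ i∈F            = i∈F
      ... | inj₂ (_ , j∈⊥ , _) = contradiction j∈⊥ ∉⊥

    join⊤ : join ⊤ ≡ ⊤
    join⊤ = ⊆-antisym ⊆⊤ λ {i} _ → full i
      where
      full : ∀ i → i ∈ˢ join ⊤
      full i with i ∈ˢ? F
      ... | yes i∈F = F⊆join ⊤ i∈F
      ... | no  i∉F with ι-surjective i∉F
      ...   | j , refl = ∈-join⁺ ∈⊤

    drop⊤ : drop ⊤ ≡ ⊤
    drop⊤ = trans (cong drop (sym join⊤)) (drop-join ⊤)

    -- As `F` is closed, the least flat of the contraction is empty and corresponds to `F` itself,
    -- so nonminimal flats of the contraction match flats strictly above `F`.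
    contract⊥ : contract cl F ⊥ ≡ ⊥
    contract⊥ = trans (cong drop (trans (trans (cong cl join⊥) flatF) (sym join⊥))) (drop-join ⊥)

    -- `contract cl F A` unfolds to `drop (cl (join A))`. If this is `A`, applying `join` gives back
    -- `cl (join A)`, which contains `F`; hence `join A` is closed.
    join-between : ∀ {A} → Between (contract cl F) (contract cl F ⊥) A → Between cl F (join A)
    join-between {A} (flat , ⊥⊂A , A⊂⊤) =
      trans (sym (join-drop (extensive (join A) ∘ F⊆join A))) (cong join flat) ,
      subst (_⊂ˢ join A) (trans (cong join contract⊥) join⊥) (join-mono-⊂ ⊥⊂A) ,
      subst (join A ⊂ˢ_) join⊤ (join-mono-⊂ A⊂⊤)

    drop-between : ∀ {G} → Between cl F G → Between (contract cl F) (contract cl F ⊥) (drop G)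
    drop-between {G} (flat , F⊂G , G⊂⊤) =
      cong drop (trans (cong cl (join-drop F⊆G)) flat) ,
      subst (_⊂ˢ drop G) (trans (trans (cong drop (sym join⊥)) (drop-join ⊥)) (sym contract⊥))
        (drop-mono-⊂ id F⊂G) ,
      subst (drop G ⊂ˢ_) drop⊤ (drop-mono-⊂ F⊆G G⊂⊤)
      where
      F⊆G : F ⊆ˢ G
      F⊆G = proj₁ F⊂G

  interval⇒contraction : ExchangeShellable (ChainComplex (Between cl F)) →
                         ExchangeShellable (Bergman (contract cl F))
  interval⇒contraction = chain-iso-shellable (between? (contract cl F) _) join drop
    join-mono drop-mono join-between drop-between (λ {A} _ → drop-join A) (join-drop ∘ proj₁ ∘ proj₁ ∘ proj₂)

  contraction⇒interval : ExchangeShellable (Bergman (contract cl F)) →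
                         ExchangeShellable (ChainComplex (Between cl F))
  contraction⇒interval = chain-iso-shellable (between? cl F) drop join
    drop-mono join-mono drop-between join-between (join-drop ∘ proj₁ ∘ proj₁ ∘ proj₂) (λ {A} _ → drop-join A)

-- Independent sets and faces of the augmented complex.

i∉p-i : ∀ {n} (A : Subset n) {i} → i ∉ˢ A - i
i∉p-i (_ ∷ A) {suc i} (there p) = i∉p-i A p

delete-mono : ∀ {n} {A B : Subset n} {i} → A ⊆ˢ B → A - i ⊆ˢ B - i
delete-mono {A = A} {i = i} A⊆B {x} x∈ =
  x∈p∧x≢y⇒x∈p-y (A⊆B (p─q⊆p A _ x∈)) λ { refl → i∉p-i A x∈ }

-- The complex with only the empty face arises where no proper flat is available, for `F = ⊤` or
-- `cl ⊥ ≡ ⊤`.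
trivial-shellable : ∀ {V : Set} {K : Complex V} → K [] → (∀ {L} → K L → L ≡ []) → ExchangeShellable K
trivial-shellable {K = K} k[] only = ([] ∷ []) , record
  { facets   = ([] , k[] , λ τ kτ _ → subst (_⊆ []) (sym (only kτ)) id) ∷ []
  ; cover    = λ { (_ , k , _) → [] , here refl , subst (_⊆ []) (sym (only k)) id , λ () }
  ; exchange = λ { here () } }

module _ {n} (f : ClosureOperator n) where
  open ClosureOperator f

  Closed : Subset n → Complex (Subset n)
  Closed F = ChainComplex (AtLeast cl F)

  between⇒atLeast : ∀ {F G} → Between cl F G → AtLeast cl F G
  between⇒atLeast (flat , F⊂G , G⊂⊤) = (flat , ⊂⇒≢ G⊂⊤) , proj₁ F⊂G

  -- A proper `F` is comparable with all flats above it, so its closed interval is a cone over the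
  -- open one with apex `F`. Above `F = ⊤` no proper flat is left.
  interval⇒closed : ∀ {F} → IsFlat cl F →
    (IsProperFlat cl F → ExchangeShellable (ChainComplex (Between cl F))) → ExchangeShellable (Closed F)
  interval⇒closed {F} flatF shellable with F ≟ˢ ⊤
  ... | yes refl = trivial-shellable ([] , λ _ _ ()) only
    where
    only : ∀ {L} → Closed ⊤ L → L ≡ []
    only {[]}    _                                 = refl
    only {G ∷ L} (((_ , G≢⊤) , ⊤⊆G) ∷ _ , _) = contradiction (⊆-antisym ⊆⊤ ⊤⊆G) G≢⊤
  ... | no F≢⊤ = cone-shellable _≟ˢ_ F cone⁺ cone⁻ fresh (shellable (flatF , F≢⊤))
    where
    cone⁺ : ∀ {L} → ChainComplex (Between cl F) L → Closed F (F ∷ L)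
    cone⁺ {L} (ps , total) = ((flatF , F≢⊤) , id) ∷
      All.map between⇒atLeast ps , tot
      where
      F⊆ : ∀ {G} → G ∈ L → F ⊆ˢ G
      F⊆ G∈ = proj₁ (proj₁ (proj₂ (All.lookup ps G∈)))
      tot : ∀ G H → G ∈ F ∷ L → H ∈ F ∷ L → G ⊆ˢ H ⊎ H ⊆ˢ G
      tot _ _ (here refl) (here refl) = inj₁ id
      tot _ _ (here refl) (there q)   = inj₁ (F⊆ q)
      tot _ _ (there p)   (here refl) = inj₂ (F⊆ p)
      tot G H (there p)   (there q)   = total G H p q

    cone⁻ : ∀ {L M} → Closed F L → M ⊆ L → F ∉ M → ChainComplex (Between cl F) M
    cone⁻ {M = M} (ps , total) M⊆L F∉M =
      All.tabulate between , λ G H p q → total G H (M⊆L p) (M⊆L q)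
      where
      between : ∀ {G} → G ∈ M → Between cl F G
      between G∈ with All.lookup ps (M⊆L G∈)
      ... | (flat , G≢⊤) , F⊆G = flat , ⊆∧≢⇒⊂ F⊆G (λ { refl → F∉M G∈ }) , ≢⊤⇒⊂⊤ G≢⊤

    fresh : ∀ {L} → ChainComplex (Between cl F) L → F ∉ L
    fresh (ps , _) F∈ = ⊂⇒≢ (proj₁ (proj₂ (All.lookup ps F∈))) refl

  -- Adding `F` to a chain of flats above it keeps it a chain. Consequently a facet over `I` without
  -- flats has `cl I ≡ ⊤`.
  closed-facet∋ : ∀ {F c} → IsProperFlat cl F → IsFacet (Closed F) c → F ∈ c
  closed-facet∋ {F} {c} properF (_ , (ps , total) , maximal) =
    maximal (F ∷ c) ((properF , id) ∷ ps , tot) there (here refl)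
    where
    tot : ∀ G H → G ∈ F ∷ c → H ∈ F ∷ c → G ⊆ˢ H ⊎ H ⊆ˢ G
    tot _ _ (here refl) (here refl) = inj₁ id
    tot _ _ (here refl) (there q)   = inj₁ (proj₂ (All.lookup ps q))
    tot _ _ (there p)   (here refl) = inj₂ (proj₂ (All.lookup ps p))
    tot G H (there p)   (there q)   = total G H p q

  closed-antimono : ∀ {F G c} → F ⊆ˢ G → Closed G c → Closed F c
  closed-antimono {F} {G} F⊆G (ps , total) = All.map widen ps , total
    where
    widen : ∀ {H} → AtLeast cl G H → AtLeast cl F H
    widen (proper , G⊆H) = proper , G⊆H ∘ F⊆G

  cl⊆ : ∀ {A B} → A ⊆ˢ cl B → cl A ⊆ˢ cl B
  cl⊆ {A} {B} A⊆ = subst (cl A ⊆ˢ_) (idempotent B) (monotone A⊆)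

  -- If `i` were in `cl (I - i)`, all of `I` and so `cl I` would be, against strictness. With the
  -- converse below, independence becomes a condition on single elements.
  independent⇒∉cl : ∀ {I} → Independent cl I → ∀ {i} → i ∈ˢ I → i ∉ˢ cl (I - i)
  independent⇒∉cl {I} ind {i} i∈I i∈cl with ind i i∈I
  ... | _ , x , x∈ , x∉ = x∉ (cl⊆ I⊆ x∈)
    where
    I⊆ : I ⊆ˢ cl (I - i)
    I⊆ {j} j∈I with j Fin.≟ i
    ... | yes refl = i∈cl
    ... | no  j≢i  = extensive _ (x∈p∧x≢y⇒x∈p-y j∈I j≢i)

  ∉cl⇒independent : ∀ {I} → (∀ {i} → i ∈ˢ I → i ∉ˢ cl (I - i)) → Independent cl I
  ∉cl⇒independent {I} out i i∈I = monotone (p─q⊆p I _) , i , extensive I i∈I , out i∈I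

  independent-delete : ∀ {I} → Independent cl I → ∀ j → Independent cl (I - j)
  independent-delete {I} ind j = ∉cl⇒independent λ {i} i∈ →
    independent⇒∉cl ind (p─q⊆p I _ i∈) ∘ monotone (delete-mono (p─q⊆p I _))

  independent-⊥ : Independent cl ⊥
  independent-⊥ = ∉cl⇒independent (λ i∈ → contradiction i∈ ∉⊥)

  -- For `j` in `J` but not in `I`, the set `I` lies in `J - j`, so `j ∈ cl J ⊆ cl I ⊆ cl (J - j)`,
  -- against independence. Thus closures grow strictly along inclusions of independent sets.
  independent-⊇ : ∀ {I J} → I ⊆ˢ J → Independent cl J → cl J ⊆ˢ cl I → J ≡ I
  independent-⊇ {I} {J} I⊆J ind clJ⊆clI = ⊆-antisym J⊆I I⊆J
    where
    J⊆I : J ⊆ˢ I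
    J⊆I {j} j∈J with j ∈ˢ? I
    ... | yes j∈I = j∈I
    ... | no  j∉I = contradiction
      (monotone (λ {i} i∈I → x∈p∧x≢y⇒x∈p-y (I⊆J i∈I) λ { refl → j∉I i∈I })
                (clJ⊆clI (extensive J j∈J)))
      (independent⇒∉cl ind j∈J)

  independent? : Decidable (Independent cl)
  independent? I = Fin.all? (λ i → (i ∈ˢ? I) →-dec (cl (I - i) ⊂ˢ? cl I))

  Vertex : Set
  Vertex = Fin n ⊎ Subset n

  _≟ᵛ_ : DecidableEquality Vertex
  _≟ᵛ_ = Sumₚ.≡-dec Fin._≟_ _≟ˢ_

  ∈-yPart⁺ : ∀ L {i} → inj₁ i ∈ L → i ∈ yPart cl L
  ∈-yPart⁺ (inj₁ _ ∷ L) (here refl) = here refl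
  ∈-yPart⁺ (inj₁ _ ∷ L) (there p)   = there (∈-yPart⁺ L p)
  ∈-yPart⁺ (inj₂ _ ∷ L) (there p)   = ∈-yPart⁺ L p

  ∈-yPart⁻ : ∀ L {i} → i ∈ yPart cl L → inj₁ i ∈ L
  ∈-yPart⁻ (inj₁ _ ∷ L) (here refl) = here refl
  ∈-yPart⁻ (inj₁ _ ∷ L) (there p)   = there (∈-yPart⁻ L p)
  ∈-yPart⁻ (inj₂ _ ∷ L) p           = there (∈-yPart⁻ L p)

  ∈-xPart⁺ : ∀ L {G} → inj₂ G ∈ L → G ∈ xPart cl L
  ∈-xPart⁺ (inj₂ _ ∷ L) (here refl) = here refl
  ∈-xPart⁺ (inj₂ _ ∷ L) (there p)   = there (∈-xPart⁺ L p)
  ∈-xPart⁺ (inj₁ _ ∷ L) (there p)   = ∈-xPart⁺ L p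

  ∈-xPart⁻ : ∀ L {G} → G ∈ xPart cl L → inj₂ G ∈ L
  ∈-xPart⁻ (inj₂ _ ∷ L) (here refl) = here refl
  ∈-xPart⁻ (inj₂ _ ∷ L) (there p)   = there (∈-xPart⁻ L p)
  ∈-xPart⁻ (inj₁ _ ∷ L) p           = there (∈-xPart⁻ L p)

  ySet : List Vertex → Subset n
  ySet L = toSubset cl (yPart cl L)

  ∈-ySet⁺ : ∀ {L i} → inj₁ i ∈ L → i ∈ˢ ySet L
  ∈-ySet⁺ {L} p = ∈-tabulateˢ⁺ _ (Anyₚ.any⁺ _ (lose (∈-yPart⁺ L p) (fromWitness refl)))

  ∈-ySet⁻ : ∀ {L i} → i ∈ˢ ySet L → inj₁ i ∈ L
  ∈-ySet⁻ {L} p with find (Anyₚ.any⁻ _ (yPart cl L) (∈-tabulateˢ⁻ _ p))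
  ... | j , j∈ , t with toWitness t
  ... | refl = ∈-yPart⁻ L j∈

  vertices⊆ : ∀ {L M : List Vertex} → (∀ {i} → inj₁ i ∈ L → inj₁ i ∈ M) →
              (∀ {G} → inj₂ G ∈ L → inj₂ G ∈ M) → L ⊆ M
  vertices⊆ ys xs {inj₁ _} = ys
  vertices⊆ ys xs {inj₂ _} = xs

  -- Faces are lists, so `L` is described by membership alone. Its flats may form any part of `c`,
  -- as parts of a chain are chains.
  augmented⁺ : ∀ {I c L} → Independent cl I → Closed (cl I) c →
    (∀ {i} → i ∈ˢ I → inj₁ i ∈ L) → (∀ {i} → inj₁ i ∈ L → i ∈ˢ I) →
    (∀ {G} → inj₂ G ∈ L → G ∈ c) → AugmentedBergman cl L
  augmented⁺ {I} {c} {L} ind closed I⊆L L⊆I L⊆c =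
    -- `AugmentedBergman cl L` unfolds to this product at `J = ySet L`.
    subst (λ J → Independent cl J × Closed (cl J) (xPart cl L)) (sym ySet≡I)
      (ind , chain-down (L⊆c ∘ ∈-xPart⁻ L) closed)
    where
    ySet≡I : ySet L ≡ I
    ySet≡I = ⊆-antisym (L⊆I ∘ ∈-ySet⁻) (∈-ySet⁺ ∘ I⊆L)

  -- The link of the vertex of `cl ⊥` contains no `y_i`: an independent set whose closure lies in
  -- `cl ⊥` is empty. If `cl ⊥` is all of `E`, this vertex does not exist and the Bergman complex
  -- has only the empty face.
  augmented⇒bergman : ExchangeShellable (AugmentedBergman cl) → ExchangeShellable (Bergman cl)
  augmented⇒bergman S with cl ⊥ ≟ˢ ⊤
  ... | yes cl⊥≡⊤ = trivial-shellable ([] , λ _ _ ()) only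
    where
    only : ∀ {L} → Bergman cl L → L ≡ []
    only {[]}    _ = refl
    only {G ∷ L} ((_ , (cl⊥⊆G , _) , G⊂⊤) ∷ _ , _) =
      contradiction (⊆-antisym ⊆⊤ (subst (_⊆ˢ G) cl⊥≡⊤ cl⊥⊆G)) (⊂⇒≢ G⊂⊤)
  ... | no cl⊥≢⊤ = Link.link-shellable _≟ᵛ_ inj₂ {τ = x₀ ∷ []} ([] ∷ [])
      (Uniqueₚ.filter⁺ P? (subsets! n)) (λ { _ _ refl → refl }) (vertices-of P?)
      fresh link⁺ restrict covered S
    where
    P? : Decidable (Between cl (cl ⊥))
    P? = between? cl (cl ⊥)

    ws : List (Subset n)
    ws = filter P? (subsets n)

    x₀ : Vertex
    x₀ = inj₂ (cl ⊥)

    fresh : ∀ {G} → G ∈ ws → inj₂ G ∉ x₀ ∷ []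
    fresh G∈ (here refl) = ⊂⇒≢ (proj₁ (proj₂ (vertex⁻ P? G∈))) refl

    link⁺ : ∀ {L} → Bergman cl L → AugmentedBergman cl (map inj₂ L ++ x₀ ∷ [])
    link⁺ {L} (ps , total) = augmented⁺ independent-⊥
      (((idempotent ⊥ , cl⊥≢⊤) , id) ∷
         All.map between⇒atLeast ps , tot)
      (λ i∈ → contradiction i∈ ∉⊥) noY onlyX
      where
      below : ∀ {G} → G ∈ L → cl ⊥ ⊆ˢ G
      below G∈ = proj₁ (proj₁ (proj₂ (All.lookup ps G∈)))
      tot : ∀ G H → G ∈ cl ⊥ ∷ L → H ∈ cl ⊥ ∷ L → G ⊆ˢ H ⊎ H ⊆ˢ G
      tot _ _ (here refl) (here refl) = inj₁ id
      tot _ _ (here refl) (there q)   = inj₁ (below q)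
      tot _ _ (there p)   (here refl) = inj₂ (below p)
      tot G H (there p)   (there q)   = total G H p q
      noY : ∀ {i} → inj₁ i ∈ map inj₂ L ++ x₀ ∷ [] → i ∈ˢ ⊥
      noY i∈ with ∈-++⁻ (map inj₂ L) i∈
      ... | inj₂ (here ())
      ... | inj₁ p with ∈-map⁻ inj₂ p
      ...   | _ , _ , ()
      onlyX : ∀ {G} → inj₂ G ∈ map inj₂ L ++ x₀ ∷ [] → G ∈ cl ⊥ ∷ L
      onlyX G∈ with ∈-++⁻ (map inj₂ L) G∈
      ... | inj₂ (here refl) = here refl
      ... | inj₁ p with ∈-map⁻ inj₂ p
      ...   | _ , q , refl = there q

    restrict : ∀ {σ L} → AugmentedBergman cl σ → x₀ ∷ [] ⊆ σ →
               (∀ {G} → G ∈ L → G ∈ ws × inj₂ G ∈ σ) → Bergman cl L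
    restrict {σ} (_ , _ , total) _ L⊆ = All.tabulate (λ G∈ → vertex⁻ P? (proj₁ (L⊆ G∈))) ,
      λ G H G∈ H∈ → total G H (∈-xPart⁺ σ (proj₂ (L⊆ G∈))) (∈-xPart⁺ σ (proj₂ (L⊆ H∈)))

    covered : ∀ {σ v} → AugmentedBergman cl σ → x₀ ∷ [] ⊆ σ → v ∈ σ →
              v ∈ x₀ ∷ [] ⊎ ∃ λ G → G ∈ ws × v ≡ inj₂ G
    -- The flat `cl ⊥` in `σ` contains the closure of the `y`-part, so `i ∈ cl ⊥`, which is
    -- contained in the closure of the other elements.
    covered {σ} {inj₁ i} (ind , ps , _) x₀∈ i∈ = contradiction
      (monotone ⊥⊆ (proj₂ (All.lookup ps (∈-xPart⁺ σ (x₀∈ (here refl)))) (extensive _ (∈-ySet⁺ i∈))))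
      (independent⇒∉cl ind (∈-ySet⁺ i∈))
    covered {σ} {inj₂ G} (_ , ps , _) x₀∈ G∈ with G ≟ˢ cl ⊥
    ... | yes refl = inj₁ (here refl)
    ... | no  G≢   with All.lookup ps (∈-xPart⁺ σ G∈)
    ...   | (flat , G≢⊤) , le = inj₂ (G ,
      ∈-filter⁺ P? (∈-subsets G) (flat , ⊆∧≢⇒⊂ (le ∘ monotone ⊥⊆) (G≢ ∘ sym) , ≢⊤⇒⊂⊤ G≢⊤) , refl)

-- The shelling of the augmented complex by closure size.

∉⇒≡[] : ∀ {A : Set} {xs : List A} → (∀ {x} → x ∉ xs) → xs ≡ []
∉⇒≡[] {xs = []}    _  = refl
∉⇒≡[] {xs = _ ∷ _} ∉xs = contradiction (here refl) ∉xs

⊆∧∣≥∣⇒⊇ : ∀ {n} {A B : Subset n} → A ⊆ˢ B → ∣ B ∣ ≤ ∣ A ∣ → B ⊆ˢ A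
⊆∧∣≥∣⇒⊇ {A = A} {B} A⊆B len with B ⊆ˢ? A
... | yes B⊆A = B⊆A
... | no  B⊈A = contradiction (p⊂q⇒∣p∣<∣q∣ (A⊆B , ⊈⇒∃ B⊈A)) (≤⇒≯ len)

module AugmentedShelling {n} (f : ClosureOperator n)
  (closed-shellable : ∀ {F} → IsFlat (ClosureOperator.cl f) F → ExchangeShellable (Closed f F)) where
  open ClosureOperator f
  open DecMembership (_≟ᵛ_ f) using (_∈?_)

  elements : Subset n → List (Fin n)
  elements I = filter (_∈ˢ? I) (allFin n)

  build : Subset n → List (Subset n) → List (Vertex f)
  build I c = map inj₁ (elements I) ++ map inj₂ c

  build-y⁺ : ∀ {I} c {i} → i ∈ˢ I → inj₁ i ∈ build I c
  build-y⁺ {I} c {i} i∈ = ∈-++⁺ˡ (∈-map⁺ inj₁ (∈-filter⁺ (_∈ˢ? I) (∈-allFin i) i∈))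

  build-y⁻ : ∀ {I} c {i} → inj₁ i ∈ build I c → i ∈ˢ I
  build-y⁻ {I} c i∈ with ∈-++⁻ (map inj₁ (elements I)) i∈
  ... | inj₁ p with ∈-map⁻ inj₁ p
  ...   | _ , q , refl = proj₂ (∈-filter⁻ (_∈ˢ? I) {xs = allFin n} q)
  build-y⁻ {I} c i∈ | inj₂ p with ∈-map⁻ inj₂ p
  ...   | _ , _ , ()

  build-x⁺ : ∀ I {c G} → G ∈ c → inj₂ G ∈ build I c
  build-x⁺ I G∈ = ∈-++⁺ʳ (map inj₁ (elements I)) (∈-map⁺ inj₂ G∈)

  build-x⁻ : ∀ I {c G} → inj₂ G ∈ build I c → G ∈ c
  build-x⁻ I G∈ with ∈-++⁻ (map inj₁ (elements I)) G∈
  ... | inj₁ p with ∈-map⁻ inj₁ p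
  ...   | _ , _ , ()
  build-x⁻ I G∈ | inj₂ p with ∈-map⁻ inj₂ p
  ...   | _ , q , refl = q

  build! : ∀ I {c} → Unique c → Unique (build I c)
  build! I {c} u = Uniqueₚ.++⁺
    (Uniqueₚ.map⁺ (λ { refl → refl }) (Uniqueₚ.filter⁺ (_∈ˢ? I) (Uniqueₚ.allFin⁺ n)))
    (Uniqueₚ.map⁺ (λ { refl → refl }) u) disjoint
    where
    disjoint : Disjoint (map inj₁ (elements I)) (map inj₂ c)
    disjoint (p , q) with ∈-map⁻ inj₁ p | ∈-map⁻ inj₂ q
    ... | _ , _ , refl | _ , _ , ()

  build-face : ∀ {I c} → Independent cl I → Closed f (cl I) c → AugmentedBergman cl (build I c)
  build-face {I} {c} ind closed = augmented⁺ f ind closed (build-y⁺ c) (build-y⁻ c) (build-x⁻ I)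

  -- A larger face has an independent set `J` containing `I`. Its closure is inside `cl I`:
  -- trivially if `cl I` is `E`, and otherwise because `cl I` belongs to `c` and thus to the larger
  -- face. Hence `J` is `I`, and the chain is maximal by assumption.
  build-facet : ∀ {I c} → Independent cl I → IsFacet (Closed f (cl I)) c →
                IsFacet (AugmentedBergman cl) (build I c)
  build-facet {I} {c} ind facet@(u , closed , maximal) = build! I u , build-face ind closed , max
    where
    max : ∀ L → AugmentedBergman cl L → build I c ⊆ L → L ⊆ build I c
    max L (indJ , ps , total) ⊆L = vertices⊆ f
      (λ i∈ → build-y⁺ c (subst (_ ∈ˢ_) J≡I (∈-ySet⁺ f i∈)))
      (λ G∈ → build-x⁺ I (maximal (xPart cl L)
        (subst (λ J → Closed f (cl J) (xPart cl L)) J≡I (ps , total))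
        (∈-xPart⁺ f L ∘ ⊆L ∘ build-x⁺ I) (∈-xPart⁺ f L G∈)))
      where
      clJ⊆clI : cl (ySet f L) ⊆ˢ cl I
      clJ⊆clI with cl I ≟ˢ ⊤
      ... | yes eq = subst (cl (ySet f L) ⊆ˢ_) (sym eq) ⊆⊤
      ... | no  ne = proj₂ (All.lookup ps (∈-xPart⁺ f L
        (⊆L (build-x⁺ I (closed-facet∋ f (idempotent I , ne) facet)))))
      J≡I : ySet f L ≡ I
      J≡I = independent-⊇ f (∈-ySet⁺ f ∘ ⊆L ∘ build-y⁺ c) indJ clJ⊆clI

  -- The size of the closure rather than of `I`: independent sets with the same closure may differ
  -- in size.
  rank : Subset n → ℕ
  rank I = ∣ cl I ∣

  rank-⊆ : ∀ {I J} → I ⊆ˢ J → Independent cl J → rank J ≤ rank I → J ≡ I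
  rank-⊆ I⊆J ind len = independent-⊇ f I⊆J ind (⊆∧∣≥∣⇒⊇ (monotone I⊆J) len)

  open import Data.List.Sort (On.decTotalOrder ≤-decTotalOrder rank) using (sort; sort-↭; sort-↗)

  private
    unsorted : List (Subset n)
    unsorted = filter (independent? f) (subsets n)

  independents : List (Subset n)
  independents = sort unsorted

  by-rank : AllPairs (λ I J → rank I ≤ rank J) independents
  by-rank = Sorted⇒AllPairs (On.totalOrder ≤-totalOrder rank) (sort-↗ unsorted)

  independents! : Unique independents
  independents! = Unique-resp-↭ (setoid _) (↭⇒↭ₛ (↭-sym (sort-↭ unsorted)))
    (Uniqueₚ.filter⁺ (independent? f) (subsets! n))

  ∈-independents⁺ : ∀ {I} → Independent cl I → I ∈ independents
  ∈-independents⁺ ind = ∈-resp-↭ (↭-sym (sort-↭ unsorted)) (∈-filter⁺ (independent? f) (∈-subsets _) ind)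

  ∈-independents⁻ : ∀ {I} → I ∈ independents → Independent cl I
  ∈-independents⁻ I∈ = proj₂ (∈-filter⁻ (independent? f) {xs = subsets n} (∈-resp-↭ (sort-↭ unsorted) I∈))

  chains : Subset n → List (List (Subset n))
  chains I = proj₁ (closed-shellable (idempotent I))

  chains-shelling : ∀ I → ExchangeShelling (Closed f (cl I)) (chains I)
  chains-shelling I = proj₂ (closed-shellable (idempotent I))

  block : Subset n → List (List (Vertex f))
  block I = map (build I) (chains I)

  order : List (List (Vertex f))
  order = concatMap block independents

  ∈-blocks⁺ : ∀ {Is I c} → I ∈ Is → c ∈ chains I → build I c ∈ concatMap block Is
  ∈-blocks⁺ {I = I} I∈ c∈ = ∈-concatMap⁺ block (lose I∈ (∈-map⁺ (build I) c∈))

  ∈-blocks⁻ : ∀ Is {σ} → σ ∈ concatMap block Is → ∃₂ λ I c → I ∈ Is × c ∈ chains I × σ ≡ build I c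
  ∈-blocks⁻ Is σ∈ with find (∈-concatMap⁻ block {xs = Is} σ∈)
  ... | I , I∈ , σ∈block with ∈-map⁻ (build I) σ∈block
  ... | c , c∈ , eq = I , c , I∈ , c∈ , eq

  order-shelling : ExchangeShelling (AugmentedBergman cl) order
  order-shelling = record { facets = All.tabulate fac ; cover = cov ; exchange = exch }
    where
    fac : ∀ {σ} → σ ∈ order → IsFacet (AugmentedBergman cl) σ
    fac σ∈ with ∈-blocks⁻ independents σ∈
    ... | I , c , I∈ , c∈ , refl =
      build-facet (∈-independents⁻ I∈) (All.lookup (facets (chains-shelling I)) c∈)

    cov : ∀ {L} → IsFacet (AugmentedBergman cl) L → ∃ λ ρ → ρ ∈ order × SameSet L ρ
    cov {L} (_ , (ind , closed) , maximal) = fromCover (cover (chains-shelling I) facet-d)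
      where
      I : Subset n
      I = ySet f L

      inL? : Decidable (λ G → inj₂ G ∈ L)
      inL? G = inj₂ G ∈? L

      -- Selecting from `subsets n` gives the flats of `L` without repetitions.
      d : List (Subset n)
      d = filter inL? (subsets n)

      d⁺ : ∀ {G} → inj₂ G ∈ L → G ∈ d
      d⁺ = ∈-filter⁺ inL? (∈-subsets _)

      d⁻ : ∀ {G} → G ∈ d → inj₂ G ∈ L
      d⁻ = proj₂ ∘ ∈-filter⁻ inL? {xs = subsets n}

      facet-d : IsFacet (Closed f (cl I)) d
      facet-d = Uniqueₚ.filter⁺ inL? (subsets! n) , chain-down (∈-xPart⁺ f L ∘ d⁻) closed ,
        λ e ke d⊆e G∈ → d⁺ (maximal (build I e) (build-face ind ke)
          (vertices⊆ f (build-y⁺ e ∘ ∈-ySet⁺ f) (build-x⁺ I ∘ d⊆e ∘ d⁺)) (build-x⁺ I G∈))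

      fromCover : (∃ λ c → c ∈ chains I × SameSet d c) → ∃ λ ρ → ρ ∈ order × SameSet L ρ
      fromCover (c , c∈ , d⊆c , c⊆d) = build I c , ∈-blocks⁺ (∈-independents⁺ ind) c∈ ,
        vertices⊆ f (build-y⁺ c ∘ ∈-ySet⁺ f) (build-x⁺ I ∘ d⊆c ∘ d⁺) ,
        vertices⊆ f (∈-ySet⁻ f ∘ build-y⁻ c) (d⁻ ∘ c⊆d ∘ build-x⁻ I)

    same-block : ∀ {pre I c} → Initial pre c (chains I) → ∀ {d} → d ∈ pre →
                 ∀ {as} → Exchange (as ++ map (build I) pre) (build I d) (build I c)
    same-block {I = I} {c} s {d} d∈ {as} with exchange (chains-shelling I) s d∈
    ... | v , v∈c , v∉d , e , e∈ , rest = inj₂ v , build-x⁺ I v∈c , v∉d ∘ build-x⁻ I ,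
      build I e , ∈-++⁺ʳ as (∈-map⁺ (build I) e∈) ,
      λ { {inj₁ i} i∈ _  → build-y⁺ e (build-y⁻ c i∈)
        ; {inj₂ G} G∈ G≢ → build-x⁺ I (rest (build-x⁻ I G∈) λ { refl → G≢ refl }) }

    -- Some i ∈ I is missing from J; the ridge σ ∖ {y_i} lies in a facet over I − i, whose closure is smaller.
    other-block : ∀ {as I} → Initial as I independents → ∀ {J} → J ∈ as → ∀ {c} → c ∈ chains I →
                  ∀ {d post} → Exchange (concatMap block as ++ post) (build J d) (build I c)
    other-block {as} {I} s {J} J∈ {c} c∈ {d} =
      inj₁ i , build-y⁺ c i∈I , i∉J ∘ build-y⁻ d ,
      build (I - i) e , ∈-++⁺ˡ (∈-blocks⁺ I-i∈as e∈) ,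
      λ { {inj₁ j} j∈ j≢ → build-y⁺ e (x∈p∧x≢y⇒x∈p-y (build-y⁻ c j∈) λ { refl → j≢ refl })
        ; {inj₂ G} G∈ _  → build-x⁺ (I - i) (c⊆e (build-x⁻ I G∈)) }
      where
      indI : Independent cl I
      indI = ∈-independents⁻ (initial-∈ s)

      -- If `I ⊆ J`, the earlier `J` has rank at most that of `I`, which forces `J ≡ I`; but each
      -- independent set is listed once.
      missing : ∃ λ i → i ∈ˢ I × i ∉ˢ J
      missing = ⊈⇒∃ λ I⊆J → AllPairs⇒initial independents! s J∈
        (rank-⊆ I⊆J (∈-independents⁻ (initial-⊆ s J∈)) (AllPairs⇒initial by-rank s J∈))

      i : Fin n
      i = proj₁ missing

      i∈I : i ∈ˢ I
      i∈I = proj₁ (proj₂ missing)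

      i∉J : i ∉ˢ J
      i∉J = proj₂ (proj₂ missing)

      I-i∈as : I - i ∈ as
      I-i∈as = initial-backward by-rank s (∈-independents⁺ (independent-delete f indI i))
        (<⇒≱ (p⊂q⇒∣p∣<∣q∣ (indI i i∈I))) (λ eq → i∉p-i I (subst (i ∈ˢ_) (sym eq) i∈I))

      -- `c` is a chain above `cl (I - i)` that is not maximal there. The facet extending it occurs
      -- in `chains (I - i)` only up to the order of its entries, whence `e′`.
      extension : ∃ λ e → e ∈ chains (I - i) × c ⊆ e
      extension with All.lookup (facets (chains-shelling I)) c∈
      ... | u , closed , _ with extend-to-facet _≟ˢ_ (chain? (atLeast? cl (cl (I - i)))) chain-down
              (vertices-of (atLeast? cl (cl (I - i)))) u
              (closed-antimono f (monotone (p─q⊆p I _)) closed)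
      ... | e , facet , c⊆e with cover (chains-shelling (I - i)) facet
      ... | e′ , e′∈ , e⊆e′ , _ = e′ , e′∈ , e⊆e′ ∘ c⊆e

      e : List (Subset n)
      e = proj₁ extension

      e∈ : e ∈ chains (I - i)
      e∈ = proj₁ (proj₂ extension)

      c⊆e : c ⊆ e
      c⊆e = proj₂ (proj₂ extension)

    exch : ∀ {pre σ} → Initial pre σ order → ∀ {ρ} → ρ ∈ pre → Exchange pre ρ σ
    exch s ρ∈ with initial-concatMap⁻ block independents s
    ... | as , I , _ , t , t′ , refl with initial-map⁻ (build I) (chains I) t′
    ... | pre , c , t″ , refl , refl with ∈-++⁻ (concatMap block as) ρ∈
    ... | inj₁ p with ∈-blocks⁻ as p
    ...   | J , d , J∈ , _ , refl = other-block t J∈ (initial-∈ t″)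
    exch s ρ∈ | as , I , _ , t , t′ , refl | pre , c , t″ , refl , refl | inj₂ p with ∈-map⁻ (build I) p
    ...   | d , d∈ , refl = same-block t″ d∈

  -- What the comparison of flags and bases needs to know about `order`: ranks never decrease,
  -- inside a block because they are constant and between blocks by the sorting.
  order-by-rank : ∀ {pre σ ρ} → Initial pre σ order → ρ ∈ pre → ∃₂ λ I J → ∃₂ λ c d →
    Independent cl J × IsFacet (Closed f (cl I)) c × IsFacet (Closed f (cl J)) d ×
    rank J ≤ rank I × σ ≡ build I c × ρ ≡ build J d
  order-by-rank s ρ∈ with initial-concatMap⁻ block independents s
  ... | as , I , _ , t , t′ , refl with initial-map⁻ (build I) (chains I) t′
  ... | pre , c , t″ , refl , refl with ∈-++⁻ (concatMap block as) ρ∈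
  ... | inj₁ p with ∈-blocks⁻ as p
  ...   | J , d , J∈ , d∈ , refl = I , J , c , d , ∈-independents⁻ (initial-⊆ t J∈) ,
    All.lookup (facets (chains-shelling I)) (initial-∈ t″) ,
    All.lookup (facets (chains-shelling J)) d∈ , AllPairs⇒initial by-rank t J∈ , refl , refl
  order-by-rank s ρ∈ | as , I , _ , t , t′ , refl | pre , c , t″ , refl , refl | inj₂ p
    with ∈-map⁻ (build I) p
  ...   | d , d∈ , refl = I , I , c , d , ∈-independents⁻ (initial-∈ t) ,
    All.lookup (facets (chains-shelling I)) (initial-∈ t″) ,
    All.lookup (facets (chains-shelling I)) (initial-⊆ t″ d∈) , ≤-refl , refl , refl

  flags-first-bases-last : FlagsFirstBasesLastShellable cl
  flags-first-bases-last = order , exchange⇒shelling order-shelling , initial⇒AllPairs order compare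
    where
    compare : ∀ {pre σ ρ} → Initial pre σ order → ρ ∈ pre →
              (NoY cl σ → NoY cl ρ) × (NoX cl ρ → NoX cl σ)
    compare s ρ∈ with order-by-rank s ρ∈
    ... | I , J , c , d , indJ , (_ , (ps , _) , _) , facet-d , rank≤ , refl , refl = noY , noX
      where
      -- With `I` empty, `J` contains `I` and has no larger rank, so `J` is empty too.
      noY : NoY cl (build I c) → NoY cl (build J d)
      noY eq = ∉⇒≡[] λ i∈ → I-empty (subst (_ ∈ˢ_) J≡I (build-y⁻ d (∈-yPart⁻ f (build J d) i∈)))
        where
        I-empty : ∀ {i} → i ∉ˢ I
        I-empty i∈ with subst (_ ∈_) eq (∈-yPart⁺ f (build I c) (build-y⁺ c i∈))
        ... | ()
        J≡I : J ≡ I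
        J≡I = rank-⊆ (λ i∈ → contradiction i∈ I-empty) indJ rank≤

      -- A facet over `J` without flats has `cl J ≡ ⊤`; the rank of `I` is then that of `⊤`, and no
      -- proper flat lies above `cl I`.
      noX : NoX cl (build J d) → NoX cl (build I c)
      noX eq = ∉⇒≡[] λ G∈ → no-flat (All.lookup ps (build-x⁻ I (∈-xPart⁻ f (build I c) G∈)))
        where
        clJ≡⊤ : cl J ≡ ⊤
        clJ≡⊤ with cl J ≟ˢ ⊤
        ... | yes eq′ = eq′
        ... | no  ne with subst (_ ∈_) eq (∈-xPart⁺ f (build J d)
                           (build-x⁺ J (closed-facet∋ f (idempotent J , ne) facet-d)))
        ...   | ()
        ⊤⊆clI : ⊤ ⊆ˢ cl I
        ⊤⊆clI = ⊆∧∣≥∣⇒⊇ ⊆⊤ (subst (λ A → ∣ A ∣ ≤ rank I) clJ≡⊤ rank≤)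
        no-flat : ∀ {G} → ¬ AtLeast cl (cl I) G
        no-flat ((_ , G≢⊤) , clI⊆G) = G≢⊤ (⊆-antisym ⊆⊤ (clI⊆G ∘ ⊤⊆clI))

-- The cycle of implications from (i) through (ii), (iii), (iv) back to (i).

theorem1p2 : (n : ℕ) (f : ClosureOperator n) →
    let cl = ClosureOperator.cl f in
    ((Shellable (Bergman cl) ⇔ (∀ F → IsProperFlat cl F → Shellable (Bergman (contract cl F))))
    × (Shellable (Bergman cl) ⇔ FlagsFirstBasesLastShellable cl))
    × (Shellable (Bergman cl) ⇔ Shellable (AugmentedBergman cl))
theorem1p2 n f = (mk⇔ i⇒ii (iv⇒i ∘ iii⇒iv ∘ ii⇒iii) , mk⇔ (ii⇒iii ∘ i⇒ii) (iv⇒i ∘ iii⇒iv)) ,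
                 mk⇔ (iii⇒iv ∘ ii⇒iii ∘ i⇒ii) iv⇒i
  where
  open ClosureOperator f

  fromShellable : ∀ {V} (_≟_ : DecidableEquality V) {K : Complex V} → Shellable K → ExchangeShellable K
  fromShellable _≟_ = Equivalence.to (Shellable⇔ExchangeShellable _≟_)

  toShellable : ∀ {V} (_≟_ : DecidableEquality V) {K : Complex V} → ExchangeShellable K → Shellable K
  toShellable _≟_ = Equivalence.from (Shellable⇔ExchangeShellable _≟_)

  i⇒ii : Shellable (Bergman cl) → ∀ F → IsProperFlat cl F → Shellable (Bergman (contract cl F))
  i⇒ii S F proper = toShellable _≟ˢ_
    (interval⇒contraction f F (proj₁ proper) (interval-shellable f proper (fromShellable _≟ˢ_ S)))

  ii⇒iii : (∀ F → IsProperFlat cl F → Shellable (Bergman (contract cl F))) → FlagsFirstBasesLastShellable cl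
  ii⇒iii S = AugmentedShelling.flags-first-bases-last f λ {F} flatF → interval⇒closed f flatF
    λ proper → contraction⇒interval f F flatF (fromShellable _≟ˢ_ (S F proper))

  iii⇒iv : FlagsFirstBasesLastShellable cl → Shellable (AugmentedBergman cl)
  iii⇒iv (σs , shelling , _) = σs , shelling

  iv⇒i : Shellable (AugmentedBergman cl) → Shellable (Bergman cl)
  iv⇒i S = toShellable _≟ˢ_ (augmented⇒bergman f (fromShellable (_≟ᵛ_ f) S))
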